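{- Let $P_{(2,0,0,0)}$ be the set of all cylindric partitions with profile $c=(2,0,0,0)$. Then, as formal power series in $q$, $$\sum_{\Lambda\in P_{(2,0,0,0)}} q^{|\Lambda|}=\left(\sum_{n\ge0}\frac{q^{n(n+1)}(-q^2;q^2)_n}{(-q^3;q^2)_n\,(q^2;q^2)_n}\right)\frac{(-q^3;q^2)_\infty}{(q;q)_\infty}.$$
   Context: Let $r,\ell$ be positive integers and $c=(c_1,\dots,c_r)$ a composition of $\ell$ into $r$ nonnegative integer parts (zero entries allowed). A cylindric partition with profile $c$ is a tuple $\Lambda=(\lambda^{(1)},\dots,\lambda^{(r)})$ of ordinary partitions $\lambda^{(i)}=(\lambda^{(i)}_1\ge\lambda^{(i)}_2\ge\cdots)$ (parts beyond the length are taken to be $0$) such that for all $i,j$: $\lambda^{(i)}_j\ge\lambda^{(i+1)}_{j+c_{i+1}}$ for $1\le i\le r-1$, and $\lambda^{(r)}_j\ge\lambda^{(1)}_{j+c_1}$. The size $|\Lambda|$ is the sum of all parts of all $\lambda^{(i)}$; the empty cylindric partition is included with size $0$. Notation: $(a;q)_n=\prod_{k=1}^n(1-aq^{k-1})$, $(a;q)_\infty=\lim_{n\to\infty}(a;q)_n$. -}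

module Defs where

open import Data.Nat as ℕ using (ℕ; zero; suc; _≤_; _∸_)
open import Data.Integer as ℤ using (ℤ; +_; -_)
open import Data.List as List using (List; []; _∷_; _++_; [_]; length)
open import Data.List.Relation.Unary.All using (All)
open import Data.List.Relation.Unary.Linked using (Linked)
open import Data.List.Relation.Unary.Unique.Propositional using (Unique)
open import Data.List.Membership.Propositional using (_∈_)
open import Data.Vec as Vec using (Vec; _∷ʳ_; lookup)
open import Data.Fin using (Fin)
open import Relation.Nullary using (yes; no)
open import Data.Nat.ListAction as LA using ()
open import Data.Vec.Relation.Unary.All renaming (All to VAll) using ()
open import Data.Product using (Σ; _×_)
open import Function.Bundles using (_⇔_)
open import Relation.Binary.PropositionalEquality using (_≡_)

-- An ordinary partition: a list of positive, weakly decreasing parts.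
-- (Trailing zeros are not stored, so each partition has a unique representation.)
IsPartition : List ℕ → Set
IsPartition l = Linked ℕ._≥_ l × All (λ x → 1 ≤ x) l

-- part λ j = λ_{j+1} (0-based index); parts beyond the length are 0.
part : List ℕ → ℕ → ℕ
part []       _       = 0
part (x ∷ xs) zero    = x
part (x ∷ xs) (suc j) = part xs j

rotate : {A : Set} {n : ℕ} → Vec A (suc n) → Vec A (suc n)
rotate (x Vec.∷ xs) = xs ∷ʳ x

CylCond : List ℕ → List ℕ → ℕ → Set
CylCond μ ν k = ∀ j → part ν (j ℕ.+ k) ≤ part μ j

-- Cylindric partition with profile c = (c₁,…,c_r):
-- λ^{(i)}_j ≥ λ^{(i+1)}_{j+c_{i+1}} (i < r) and λ^{(r)}_j ≥ λ^{(1)}_{j+c₁}.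
IsCylindric : {n : ℕ} → Vec ℕ (suc n) → Vec (List ℕ) (suc n) → Set
IsCylindric c Λ =
  VAll IsPartition Λ
  × (∀ (i : Fin _) → CylCond (lookup Λ i) (lookup (rotate Λ) i) (lookup (rotate c) i))

size : {n : ℕ} → Vec (List ℕ) n → ℕ
size Λ = Vec.sum (Vec.map LA.sum Λ)

HasCount : {A : Set} → (A → Set) → ℕ → Set
HasCount {A} P k = Σ (List A) λ L → Unique L × (∀ a → (a ∈ L) ⇔ P a) × length L ≡ k

Series : Set
Series = ℕ → ℤ

Σ≤ : ℕ → (ℕ → ℤ) → ℤ
Σ≤ zero    f = f 0
Σ≤ (suc n) f = Σ≤ n f ℤ.+ f (suc n)

𝟙 : Series
𝟙 zero    = + 1
𝟙 (suc _) = + 0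

qˆ : ℕ → Series
qˆ d n with d ℕ.≟ n
... | yes _ = + 1
... | no  _ = + 0

_⊕_ : Series → Series → Series
(f ⊕ g) n = f n ℤ.+ g n

⊖_ : Series → Series
(⊖ f) n = - f n

_⊗_ : Series → Series → Series
(f ⊗ g) n = Σ≤ n (λ k → f k ℤ.* g (n ∸ k))

infixl 6 _⊕_
infixl 7 _⊗_

_^ˢ_ : Series → ℕ → Series
f ^ˢ zero  = 𝟙
f ^ˢ suc n = f ^ˢ n ⊗ f

at : List ℤ → ℕ → ℤ
at []       _       = + 0
at (x ∷ xs) zero    = x
at (x ∷ xs) (suc j) = at xs j

-- coefficients g₀,…,g_n of the multiplicative inverse g of f,
-- for f with constant term 1:  g₀ = 1,  g_m = - Σ_{k=1}^{m} f_k g_{m-k}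
invList : Series → ℕ → List ℤ
invList f zero    = + 1 ∷ []
invList f (suc n) =
  let prev = invList f n in
  prev ++ [ - Σ≤ n (λ k → f (suc k) ℤ.* at prev (n ∸ k)) ]

-- 1/f (meaningful when f has constant term 1, as for all uses below)
inv : Series → Series
inv f n = at (invList f n) n

poch : Series → Series → ℕ → Series
poch a Q zero    = 𝟙
poch a Q (suc n) = poch a Q n ⊗ (𝟙 ⊕ ⊖ (a ⊗ Q ^ˢ n))

-- (a;Q)_∞, when a and Q have zero constant term: the k-th factor is
-- 1 + O(q^{k+1}), so the coefficient of q^N is already that of the
-- finite product of the first N+1 factors.
pochInf : Series → Series → Series
pochInf a Q N = poch a Q (suc N) N

q q² : Series
q  = qˆ 1
q² = qˆ 2

summand : ℕ → Series
summand n = qˆ (n ℕ.* suc n) ⊗ poch (⊖ qˆ 2) q² n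
            ⊗ inv (poch (⊖ qˆ 3) q² n ⊗ poch q² q² n)

-- Σ_{n≥0} summand n; summand n = O(q^{n(n+1)}), so for the coefficient of
-- q^N only n ≤ N contribute.
sumSeries : Series
sumSeries N = Σ≤ N (λ n → summand n N)

rhs : Series
rhs = sumSeries ⊗ pochInf (⊖ qˆ 3) q² ⊗ inv (pochInf q q)

profile : Vec ℕ 4
profile = 2 Vec.∷ 0 Vec.∷ 0 Vec.∷ 0 Vec.∷ Vec.[]

{-# OPTIONS --safe #-}

-- For each h ≥ 1 the cells of Λ with entry at least h form a shape (x , y) with y ≤ x ≤ 4 + y: x cells have
-- odd and y cells even index in their partition.  So Λ is a decreasing chain of shapes.  Let A x y be
-- the generating function of the chains below (x , y); splitting off the shapes equal to the bound gives
--   A (x+1) (y+1) + A x y = A (x+1) y + A x (y+1) + q^(x+y+2) A (x+1) (y+1).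
-- With Q = q², let b, a, c be (q;q)_{2m} times A (m+1) (m−1), A m m, A (m+2) (m−2), and w = a + c.  Then
--   b′ = (1 + q Q^m) b + Q^m w,   w′ = 2 b + Q^m w.
-- On the other side, by telescoping,
--   H_k = Σ_n Q^{kn + n(n−1)/2} (−Q;Q)_n / (Q;Q)_n (−q Q^{n+k};Q)_∞
-- satisfies H_k = (1 + z + q z) H_{k+1} + z Q (1 − q z) H_{k+2} with z = Q^k.  Hence
--   (H_m − Q^m H_{m+1}) b_m + Q^m H_{m+1} w_m
-- does not depend on m: at the start it is H_1, the sum times (−q³;q²)_∞, and in the limit it is
-- (q;q)_∞ times the generating function of all chains.  Modulo q^(N+1) every sum and product is finite.
module Submission where

open import Defs
open import Algebra.Bundles using (CommutativeRing)
open import Algebra.Solver.Ring.AlmostCommutativeRing using (fromCommutativeRing; _-Raw-AlmostCommutative⟶_)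
open import Data.Empty using (⊥-elim)
open import Data.Fin using (Fin)
open import Data.Fin.Patterns using (0F; 1F; 2F; 3F)
open import Data.Integer as ℤ using (ℤ; +_; -_)
import Data.Integer.Properties as ℤₚ
import Data.Integer.Solver as ℤSolver
open import Data.List using (List; []; _∷_; _++_; [_]; length; map; filter)
import Data.List.Properties as Listₚ
open import Data.List.Membership.Propositional using (_∈_)
open import Data.List.Membership.Propositional.Properties using (∈-map⁺; ∈-map⁻; ∈-++⁺ˡ; ∈-++⁺ʳ; ∈-++⁻; ∈-filter⁺; ∈-filter⁻)
open import Data.List.Membership.Propositional.Properties.WithK using (unique∧set⇒bag)
open import Data.List.Relation.Binary.BagAndSetEquality using (∼bag⇒↭)
open import Data.List.Relation.Binary.Permutation.Propositional.Properties using (↭-length)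
open import Data.List.Relation.Unary.All as All using (All; []; _∷_)
import Data.List.Relation.Unary.All.Properties as Allₚ
open import Data.List.Relation.Unary.AllPairs using ([]; _∷_)
open import Data.List.Relation.Unary.Any using (here; there)
open import Data.List.Relation.Unary.Linked as Linked using (Linked; []; [-]; _∷_)
open import Data.List.Relation.Unary.Unique.Propositional using (Unique)
import Data.List.Relation.Unary.Unique.Propositional.Properties as Uniqueₚ
open import Data.Maybe using (Maybe; just; nothing)
open import Data.Nat as ℕ using (ℕ; zero; suc; pred; _≤_; _<_; _≥_; _∸_; z≤n; s≤s; ⌊_/2⌋; ⌈_/2⌉)
open import Data.Nat.ListAction using (sum)
import Data.Nat.Properties as ℕₚ
import Data.Nat.Solver as ℕSolver
open import Data.Product using (_×_; ∃; _,_; proj₁; proj₂)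
open import Data.Sum using (_⊎_; inj₁; inj₂; [_,_]′)
open import Data.Unit using (⊤; tt)
open import Data.Vec using (Vec; []; _∷_; lookup)
open import Data.Vec.Relation.Unary.All using ([]; _∷_)
open import Function using (_∘_; _⇔_; mk⇔; module Equivalence)
open import Relation.Binary.PropositionalEquality using (_≡_; _≢_; refl; sym; trans; cong; cong₂; subst; subst₂; module ≡-Reasoning)
import Relation.Binary.Reasoning.Setoid as SetoidReasoning
open import Relation.Nullary using (Dec; yes; no; ¬_; contradiction; _×-dec_)

-- The ring ℤ[[q]] / (q^(N+1))

-- At each height the four lengths satisfy ℓ₁ ≥ ℓ₂ ≥ ℓ₃ ≥ ℓ₄ ≥ ℓ₁ - 2. Halving them, rounded up and
-- rounded down, gives two vectors that obey the same conditions with 1 in place of 2, and such a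
-- vector is determined by its sum. So the four lengths reduce to two sums x and y, and the strip y
-- ≤ x ≤ 4 + y is the sum of ⌊ℓ/2⌋ ≤ ⌈ℓ/2⌉ ≤ ⌊ℓ/2⌋ + 1 over the four partitions. The invariant and
-- the recurrence for H_k are forced by each other. If u_m b_m + v_m w_m is not to depend on m,
-- comparing the coefficients of w_m gives v_m = Q^m (u_(m+1) + v_(m+1)). With H_m = u_m + v_m this
-- says v_m = Q^m H_(m+1) and u_m = H_m - Q^m H_(m+1), and comparing the coefficients of b_m is then
-- exactly the stated recurrence. What remains is to exhibit a solution that tends to 1 and whose
-- value at k = 1 is the right-hand side.

infix 4 _≗ˢ_
_≗ˢ_ : Series → Series → Set
f ≗ˢ g = ∀ n → f n ≡ g n

Σ≤-cong : ∀ n {f g : ℕ → ℤ} → (∀ k → k ≤ n → f k ≡ g k) → Σ≤ n f ≡ Σ≤ n g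
Σ≤-cong zero    eq = eq 0 z≤n
Σ≤-cong (suc n) eq =
  cong₂ ℤ._+_ (Σ≤-cong n λ k k≤n → eq k (ℕₚ.m≤n⇒m≤1+n k≤n)) (eq (suc n) ℕₚ.≤-refl)

Σ≤-+ : ∀ n (f g : ℕ → ℤ) → Σ≤ n (λ k → f k ℤ.+ g k) ≡ Σ≤ n f ℤ.+ Σ≤ n g
Σ≤-+ zero    f g = refl
Σ≤-+ (suc n) f g = trans (cong (ℤ._+ (f (suc n) ℤ.+ g (suc n))) (Σ≤-+ n f g))
  (solve 4 (λ a b c d → (a :+ b) :+ (c :+ d) := (a :+ c) :+ (b :+ d)) refl
    (Σ≤ n f) (Σ≤ n g) (f (suc n)) (g (suc n)))
  where open ℤSolver.+-*-Solver

Σ≤-*ˡ : ∀ n c (f : ℕ → ℤ) → Σ≤ n (λ k → c ℤ.* f k) ≡ c ℤ.* Σ≤ n f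
Σ≤-*ˡ zero    c f = refl
Σ≤-*ˡ (suc n) c f =
  trans (cong (ℤ._+ (c ℤ.* f (suc n))) (Σ≤-*ˡ n c f)) (sym (ℤₚ.*-distribˡ-+ c (Σ≤ n f) (f (suc n))))

Σ≤-0 : ∀ n (f : ℕ → ℤ) → (∀ k → k ≤ n → f k ≡ + 0) → Σ≤ n f ≡ + 0
Σ≤-0 zero    f eq = eq 0 z≤n
Σ≤-0 (suc n) f eq =
  cong₂ ℤ._+_ (Σ≤-0 n f λ k k≤n → eq k (ℕₚ.m≤n⇒m≤1+n k≤n)) (eq (suc n) ℕₚ.≤-refl)

Σ≤-head : ∀ n (f : ℕ → ℤ) → Σ≤ (suc n) f ≡ f 0 ℤ.+ Σ≤ n (f ∘ suc)
Σ≤-head zero    f = refl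
Σ≤-head (suc n) f = trans (cong (ℤ._+ f (suc (suc n))) (Σ≤-head n f)) (ℤₚ.+-assoc (f 0) _ _)

tail : Series → Series
tail f n = f (suc n)

scale : ℤ → Series → Series
scale c f n = c ℤ.* f n

⊗-headˡ : ∀ f g n → (f ⊗ g) (suc n) ≡ f 0 ℤ.* g (suc n) ℤ.+ (tail f ⊗ g) n
⊗-headˡ f g n = Σ≤-head n (λ k → f k ℤ.* g (suc n ∸ k))

⊗-headʳ : ∀ f g n → (f ⊗ g) (suc n) ≡ (f ⊗ tail g) n ℤ.+ f (suc n) ℤ.* g 0
⊗-headʳ f g n = cong₂ ℤ._+_
  (Σ≤-cong n λ k k≤n → cong (λ m → f k ℤ.* g m) (ℕₚ.+-∸-assoc 1 k≤n))
  (cong (λ m → f (suc n) ℤ.* g m) (ℕₚ.n∸n≡0 n))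

-- Splitting off the first term of one product matches splitting off the last term of the other, so
-- induction on the coefficient replaces the reversal of the sum.
⊗-comm : ∀ f g → f ⊗ g ≗ˢ g ⊗ f
⊗-comm f g zero    = ℤₚ.*-comm (f 0) (g 0)
⊗-comm f g (suc n) = begin
  (f ⊗ g) (suc n)                           ≡⟨ ⊗-headˡ f g n ⟩
  f 0 ℤ.* g (suc n) ℤ.+ (tail f ⊗ g) n      ≡⟨ ℤₚ.+-comm _ ((tail f ⊗ g) n) ⟩
  (tail f ⊗ g) n ℤ.+ f 0 ℤ.* g (suc n)      ≡⟨ cong₂ ℤ._+_ (⊗-comm (tail f) g n) (ℤₚ.*-comm (f 0) _) ⟩
  (g ⊗ tail f) n ℤ.+ g (suc n) ℤ.* f 0      ≡⟨ sym (⊗-headʳ g f n) ⟩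
  (g ⊗ f) (suc n)                           ∎
  where open ≡-Reasoning

⊗-distribˡ : ∀ f g h → f ⊗ (g ⊕ h) ≗ˢ f ⊗ g ⊕ f ⊗ h
⊗-distribˡ f g h n = trans
  (Σ≤-cong n λ k _ → ℤₚ.*-distribˡ-+ (f k) (g (n ∸ k)) (h (n ∸ k)))
  (Σ≤-+ n (λ k → f k ℤ.* g (n ∸ k)) (λ k → f k ℤ.* h (n ∸ k)))

⊗-distribʳ : ∀ f g h → (g ⊕ h) ⊗ f ≗ˢ g ⊗ f ⊕ h ⊗ f
⊗-distribʳ f g h n = trans (⊗-comm (g ⊕ h) f n)
  (trans (⊗-distribˡ f g h n) (cong₂ ℤ._+_ (⊗-comm f g n) (⊗-comm f h n)))

scale-⊗ : ∀ c f g → scale c f ⊗ g ≗ˢ scale c (f ⊗ g)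
scale-⊗ c f g n = trans
  (Σ≤-cong n λ k _ → ℤₚ.*-assoc c (f k) (g (n ∸ k)))
  (Σ≤-*ˡ n c (λ k → f k ℤ.* g (n ∸ k)))

⊗-cong-≤ : ∀ n {f f′ g g′ : Series} → (∀ k → k ≤ n → f k ≡ f′ k) → (∀ k → k ≤ n → g k ≡ g′ k) →
           (f ⊗ g) n ≡ (f′ ⊗ g′) n
⊗-cong-≤ n ff gg = Σ≤-cong n λ k k≤n → cong₂ ℤ._*_ (ff k k≤n) (gg (n ∸ k) (ℕₚ.m∸n≤m n k))

-- Induction on the coefficient, with `f` split into its constant term and its tail; this avoids
-- exchanging a double sum.
⊗-assoc : ∀ f g h → (f ⊗ g) ⊗ h ≗ˢ f ⊗ (g ⊗ h)
⊗-assoc f g h zero    = ℤₚ.*-assoc (f 0) (g 0) (h 0)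
⊗-assoc f g h (suc n) = begin
  ((f ⊗ g) ⊗ h) (suc n)
    ≡⟨ ⊗-headˡ (f ⊗ g) h n ⟩
  f 0 ℤ.* g 0 ℤ.* h (suc n) ℤ.+ (tail (f ⊗ g) ⊗ h) n
    ≡⟨ cong (ℤ._+_ (f 0 ℤ.* g 0 ℤ.* h (suc n))) (⊗-cong-≤ n {g = h} (λ k _ → ⊗-headˡ f g k) (λ _ _ → refl)) ⟩
  f 0 ℤ.* g 0 ℤ.* h (suc n) ℤ.+ ((scale (f 0) (tail g) ⊕ tail f ⊗ g) ⊗ h) n
    ≡⟨ cong (ℤ._+_ (f 0 ℤ.* g 0 ℤ.* h (suc n))) (⊗-distribʳ h (scale (f 0) (tail g)) (tail f ⊗ g) n) ⟩
  f 0 ℤ.* g 0 ℤ.* h (suc n) ℤ.+ ((scale (f 0) (tail g) ⊗ h) n ℤ.+ ((tail f ⊗ g) ⊗ h) n)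
    ≡⟨ cong (ℤ._+_ (f 0 ℤ.* g 0 ℤ.* h (suc n))) (cong₂ ℤ._+_ (scale-⊗ (f 0) (tail g) h n) (⊗-assoc (tail f) g h n)) ⟩
  f 0 ℤ.* g 0 ℤ.* h (suc n) ℤ.+ (f 0 ℤ.* (tail g ⊗ h) n ℤ.+ (tail f ⊗ (g ⊗ h)) n)
    ≡⟨ solve 5 (λ a b c d e → a :* b :* c :+ (a :* d :+ e) := a :* (b :* c :+ d) :+ e) refl
         (f 0) (g 0) (h (suc n)) ((tail g ⊗ h) n) ((tail f ⊗ (g ⊗ h)) n) ⟩
  f 0 ℤ.* (g 0 ℤ.* h (suc n) ℤ.+ (tail g ⊗ h) n) ℤ.+ (tail f ⊗ (g ⊗ h)) n
    ≡⟨ cong (λ t → f 0 ℤ.* t ℤ.+ (tail f ⊗ (g ⊗ h)) n) (sym (⊗-headˡ g h n)) ⟩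
  f 0 ℤ.* (g ⊗ h) (suc n) ℤ.+ (tail f ⊗ (g ⊗ h)) n
    ≡⟨ sym (⊗-headˡ f (g ⊗ h) n) ⟩
  (f ⊗ (g ⊗ h)) (suc n) ∎
  where
  open ≡-Reasoning
  open ℤSolver.+-*-Solver

𝟘 : Series
𝟘 _ = + 0

const : ℤ → Series
const c zero    = c
const c (suc _) = + 0

const-⊗ : ∀ c f → const c ⊗ f ≗ˢ scale c f
const-⊗ c f zero    = refl
const-⊗ c f (suc n) = trans (⊗-headˡ (const c) f n)
  (trans (cong (ℤ._+_ (c ℤ.* f (suc n))) (Σ≤-0 n _ λ k _ → refl)) (ℤₚ.+-identityʳ _))

𝟙≗const : 𝟙 ≗ˢ const (+ 1)
𝟙≗const zero    = refl
𝟙≗const (suc n) = refl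

⊗-identityˡ : ∀ f → 𝟙 ⊗ f ≗ˢ f
⊗-identityˡ f n = trans (⊗-cong-≤ n {g = f} (λ k _ → 𝟙≗const k) (λ _ _ → refl))
  (trans (const-⊗ (+ 1) f n) (ℤₚ.*-identityˡ (f n)))

infix 4 _≈[_]_
-- Congruence modulo q^(N+1). The record keeps `f` and `g` visible to unification, which a bare
-- equality of coefficients would not.
record _≈[_]_ (f : Series) (N : ℕ) (g : Series) : Set where
  constructor mk
  field coeff : ∀ n → n ≤ N → f n ≡ g n
open _≈[_]_

≗⇒≈ : ∀ {N f g} → f ≗ˢ g → f ≈[ N ] g
≗⇒≈ eq = mk λ n _ → eq n

truncatedRing : ℕ → CommutativeRing _ _
truncatedRing N = record
  { Carrier = Series
  ; _≈_ = _≈[ N ]_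
  ; _+_ = _⊕_
  ; _*_ = _⊗_
  ; -_  = ⊖_
  ; 0#  = 𝟘
  ; 1#  = 𝟙
  ; isCommutativeRing = record
    { isRing = record
      { +-isAbelianGroup = record
        { isGroup = record
          { isMonoid = record
            { isSemigroup = record
              { isMagma = record
                { isEquivalence = record
                  { refl  = ≗⇒≈ λ _ → refl
                  ; sym   = λ p → mk λ n n≤N → sym (coeff p n n≤N)
                  ; trans = λ p r → mk λ n n≤N → trans (coeff p n n≤N) (coeff r n n≤N)
                  }
                ; ∙-cong = λ p r → mk λ n n≤N → cong₂ ℤ._+_ (coeff p n n≤N) (coeff r n n≤N)
                }
              ; assoc = λ f g h → ≗⇒≈ λ n → ℤₚ.+-assoc (f n) (g n) (h n)
              }
            ; identity = (λ f → ≗⇒≈ λ n → ℤₚ.+-identityˡ (f n)) , (λ f → ≗⇒≈ λ n → ℤₚ.+-identityʳ (f n))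
            }
          ; inverse = (λ f → ≗⇒≈ λ n → ℤₚ.+-inverseˡ (f n)) , (λ f → ≗⇒≈ λ n → ℤₚ.+-inverseʳ (f n))
          ; ⁻¹-cong = λ p → mk λ n n≤N → cong -_ (coeff p n n≤N)
          }
        ; comm = λ f g → ≗⇒≈ λ n → ℤₚ.+-comm (f n) (g n)
        }
      ; *-cong = λ p r → mk λ n n≤N →
          ⊗-cong-≤ n (λ k k≤n → coeff p k (ℕₚ.≤-trans k≤n n≤N)) (λ k k≤n → coeff r k (ℕₚ.≤-trans k≤n n≤N))
      ; *-assoc = λ f g h → ≗⇒≈ λ n → ⊗-assoc f g h n
      ; *-identity = (λ f → ≗⇒≈ λ n → ⊗-identityˡ f n) , (λ f → ≗⇒≈ λ n → trans (⊗-comm f 𝟙 n) (⊗-identityˡ f n))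
      ; distrib = (λ f g h → ≗⇒≈ λ n → ⊗-distribˡ f g h n) , (λ f g h → ≗⇒≈ λ n → ⊗-distribʳ f g h n)
      }
    ; *-comm = λ f g → ≗⇒≈ λ n → ⊗-comm f g n
    }
  }

-- The values at 0 and 1 are 𝟘 and 𝟙 themselves, so that the ring solver recognises these as constants.
ι : ℤ → Series
ι (+ 0) = 𝟘
ι (+ 1) = 𝟙
ι c     = const c

ι≗const : ∀ c → ι c ≗ˢ const c
ι≗const (+ 0)             zero    = refl
ι≗const (+ 0)             (suc n) = refl
ι≗const (+ 1)             n = 𝟙≗const n
ι≗const (+ suc (suc _))   n = refl
ι≗const (ℤ.-[1+ _ ])      n = refl

ιHomomorphism : ∀ N →
  CommutativeRing.rawRing ℤₚ.+-*-commutativeRing -Raw-AlmostCommutative⟶ fromCommutativeRing (truncatedRing N)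
ιHomomorphism N = record
  { ⟦_⟧    = ι
  ; +-homo = λ a b → ≗⇒≈ λ n → trans (ι≗const (a ℤ.+ b) n)
      (trans (const-+ a b n) (cong₂ ℤ._+_ (sym (ι≗const a n)) (sym (ι≗const b n))))
  ; *-homo = λ a b → ≗⇒≈ λ n → trans (ι≗const (a ℤ.* b) n)
      (trans (const-* a b n) (sym (⊗-cong-≤ n (λ k _ → ι≗const a k) (λ k _ → ι≗const b k))))
  ; -‿homo = λ a → ≗⇒≈ λ n → trans (ι≗const (- a) n) (trans (const-neg a n) (cong -_ (sym (ι≗const a n))))
  ; 0-homo = ≗⇒≈ λ _ → refl
  ; 1-homo = ≗⇒≈ λ _ → refl
  }
  where
  const-+ : ∀ a b → const (a ℤ.+ b) ≗ˢ const a ⊕ const b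
  const-+ a b zero    = refl
  const-+ a b (suc _) = refl
  const-* : ∀ a b → const (a ℤ.* b) ≗ˢ const a ⊗ const b
  const-* a b zero    = refl
  const-* a b (suc n) = sym (trans (const-⊗ a (const b) (suc n)) (ℤₚ.*-zeroʳ a))
  const-neg : ∀ a → const (- a) ≗ˢ ⊖ const a
  const-neg a zero    = refl
  const-neg a (suc _) = refl

ι-≟ : ∀ N a b → Maybe (ι a ≈[ N ] ι b)
ι-≟ N a b with a ℤ.≟ b
... | yes refl = just (≗⇒≈ λ _ → refl)
... | no  _    = nothing

module Truncated (N : ℕ) where

  open CommutativeRing (truncatedRing N) public
    using (_≈_; setoid; *-assoc; *-comm; *-identityˡ; *-identityʳ; zeroˡ; +-identityʳ; +-comm)
    renaming (refl to ≈-refl; sym to ≈-sym; trans to ≈-trans; reflexive to ≈-reflexive)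

  open import Algebra.Solver.Ring (CommutativeRing.rawRing ℤₚ.+-*-commutativeRing)
    (fromCommutativeRing (truncatedRing N)) (ιHomomorphism N) (ι-≟ N) public
    using (solve; Polynomial; _:=_; _:+_; _:*_; :-_; con)

  one : ∀ {m} → Polynomial m
  one = con (+ 1)

  ⊗-congˡ : ∀ f {g h} → g ≈ h → f ⊗ g ≈ f ⊗ h
  ⊗-congˡ f {g} {h} = CommutativeRing.*-cong (truncatedRing N) {f} {f} {g} {h} ≈-refl

  ⊗-congʳ : ∀ f {g h} → g ≈ h → g ⊗ f ≈ h ⊗ f
  ⊗-congʳ f {g} {h} p = CommutativeRing.*-cong (truncatedRing N) {g} {h} {f} {f} p ≈-refl

  ⊕-congˡ : ∀ f {g h} → g ≈ h → f ⊕ g ≈ f ⊕ h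
  ⊕-congˡ f {g} {h} = CommutativeRing.+-cong (truncatedRing N) {f} {f} {g} {h} ≈-refl

  ⊕-congʳ : ∀ f {g h} → g ≈ h → g ⊕ f ≈ h ⊕ f
  ⊕-congʳ f {g} {h} p = CommutativeRing.+-cong (truncatedRing N) {g} {h} {f} {f} p ≈-refl

  ⊕-cong : ∀ {f f′ g g′} → f ≈ f′ → g ≈ g′ → f ⊕ g ≈ f′ ⊕ g′
  ⊕-cong {f} {f′} {g} {g′} = CommutativeRing.+-cong (truncatedRing N) {f} {f′} {g} {g′}

  ⊗-cong : ∀ {f f′ g g′} → f ≈ f′ → g ≈ g′ → f ⊗ g ≈ f′ ⊗ g′
  ⊗-cong {f} {f′} {g} {g′} = CommutativeRing.*-cong (truncatedRing N) {f} {f′} {g} {g′}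

  ⊖-cong : ∀ {f g} → f ≈ g → ⊖ f ≈ ⊖ g
  ⊖-cong {f} {g} = CommutativeRing.-‿cong (truncatedRing N) {f} {g}

-- Powers of q, inverses and q-Pochhammer symbols

qˆ-suc : ∀ d → tail (qˆ (suc d)) ≗ˢ qˆ d
qˆ-suc d n with suc d ℕ.≟ suc n | d ℕ.≟ n
... | yes _ | yes _ = refl
... | no  _ | no  _ = refl
... | yes p | no ¬p = contradiction (ℕₚ.suc-injective p) ¬p
... | no ¬p | yes p = contradiction (cong suc p) ¬p

qˆ-0 : qˆ 0 ≗ˢ 𝟙
qˆ-0 zero    = refl
qˆ-0 (suc n) = refl

qˆ-low : ∀ d n → n < d → qˆ d n ≡ + 0
qˆ-low (suc d) zero    _         = refl
qˆ-low (suc d) (suc n) (s≤s n<d) = trans (qˆ-suc d n) (qˆ-low d n n<d)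

qˆ-suc-⊗ : ∀ d f n → (qˆ (suc d) ⊗ f) (suc n) ≡ (qˆ d ⊗ f) n
qˆ-suc-⊗ d f n = trans (⊗-headˡ (qˆ (suc d)) f n)
  (trans (ℤₚ.+-identityˡ _) (⊗-cong-≤ n {g = f} (λ k _ → qˆ-suc d k) (λ _ _ → refl)))

qˆ-⊗-shift : ∀ d f n → (qˆ d ⊗ f) (d ℕ.+ n) ≡ f n
qˆ-⊗-shift zero    f n = trans (⊗-cong-≤ n {g = f} (λ k _ → qˆ-0 k) (λ _ _ → refl)) (⊗-identityˡ f n)
qˆ-⊗-shift (suc d) f n = trans (qˆ-suc-⊗ d f (d ℕ.+ n)) (qˆ-⊗-shift d f n)

qˆ-⊗-low : ∀ d f n → n < d → (qˆ d ⊗ f) n ≡ + 0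
qˆ-⊗-low (suc d) f zero    _         = refl
qˆ-⊗-low (suc d) f (suc n) (s≤s n<d) = trans (qˆ-suc-⊗ d f n) (qˆ-⊗-low d f n n<d)

qˆ-+ : ∀ d e → qˆ d ⊗ qˆ e ≗ˢ qˆ (d ℕ.+ e)
qˆ-+ zero    e n       = trans (⊗-cong-≤ n {g = qˆ e} (λ k _ → qˆ-0 k) (λ _ _ → refl)) (⊗-identityˡ (qˆ e) n)
qˆ-+ (suc d) e zero    = refl
qˆ-+ (suc d) e (suc n) = trans (qˆ-suc-⊗ d (qˆ e) n) (trans (qˆ-+ d e n) (sym (qˆ-suc (d ℕ.+ e) n)))

length-invList : ∀ f n → length (invList f n) ≡ suc n
length-invList f zero    = refl
length-invList f (suc n) = trans (Listₚ.length-++ (invList f n))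
  (trans (cong (ℕ._+ 1) (length-invList f n)) (ℕₚ.+-comm (suc n) 1))

at-++ˡ : ∀ xs ys j → j < length xs → at (xs ++ ys) j ≡ at xs j
at-++ˡ (x ∷ xs) ys zero    _         = refl
at-++ˡ (x ∷ xs) ys (suc j) (s≤s j<n) = at-++ˡ xs ys j j<n

at-++-length : ∀ xs y → at (xs ++ [ y ]) (length xs) ≡ y
at-++-length []       y = refl
at-++-length (x ∷ xs) y = at-++-length xs y

-- Each list extends the previous one at its end, so an entry once computed never changes.
at-invList : ∀ f n j → j ≤ n → at (invList f n) j ≡ inv f j
at-invList f zero    zero z≤n = refl
at-invList f (suc n) j    j≤n with j ℕ.≟ suc n
... | yes refl = refl
... | no j≢ = trans
  (at-++ˡ (invList f n) _ j (subst (j <_) (sym (length-invList f n)) j<n)) (at-invList f n j (ℕₚ.≤-pred j<n))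
  where j<n = ℕₚ.≤∧≢⇒< j≤n j≢

inv-suc : ∀ f n → inv f (suc n) ≡ - (tail f ⊗ inv f) n
inv-suc f n = trans
  (subst (λ m → at (invList f (suc n)) m ≡ - Σ≤ n (λ k → f (suc k) ℤ.* at (invList f n) (n ∸ k)))
    (length-invList f n) (at-++-length (invList f n) _))
  (cong -_ (Σ≤-cong n λ k _ → cong (ℤ._*_ (f (suc k))) (at-invList f n (n ∸ k) (ℕₚ.m∸n≤m n k))))

⊗-inv : ∀ f → f 0 ≡ + 1 → f ⊗ inv f ≗ˢ 𝟙
⊗-inv f f0 zero    = trans (cong (ℤ._* + 1) f0) refl
⊗-inv f f0 (suc n) = begin
  (f ⊗ inv f) (suc n)                                      ≡⟨ ⊗-headˡ f (inv f) n ⟩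
  f 0 ℤ.* inv f (suc n) ℤ.+ (tail f ⊗ inv f) n             ≡⟨ cong₂ (λ a b → a ℤ.* b ℤ.+ (tail f ⊗ inv f) n) f0 (inv-suc f n) ⟩
  + 1 ℤ.* - (tail f ⊗ inv f) n ℤ.+ (tail f ⊗ inv f) n      ≡⟨ cong (ℤ._+ (tail f ⊗ inv f) n) (ℤₚ.*-identityˡ (- (tail f ⊗ inv f) n)) ⟩
  - (tail f ⊗ inv f) n ℤ.+ (tail f ⊗ inv f) n              ≡⟨ ℤₚ.+-inverseˡ ((tail f ⊗ inv f) n) ⟩
  + 0                                                      ∎
  where open ≡-Reasoning

⊗-const-term : ∀ f g → f 0 ≡ + 1 → g 0 ≡ + 1 → (f ⊗ g) 0 ≡ + 1
⊗-const-term f g f0 g0 = cong₂ ℤ._*_ f0 g0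

poch-const-term : ∀ a Q n → a 0 ≡ + 0 → poch a Q n 0 ≡ + 1
poch-const-term a Q zero    a0 = refl
poch-const-term a Q (suc n) a0 = ⊗-const-term (poch a Q n) (𝟙 ⊕ ⊖ (a ⊗ Q ^ˢ n)) (poch-const-term a Q n a0)
  (cong (λ z → + 1 ℤ.+ - (z ℤ.* (Q ^ˢ n) 0)) a0)

ΣS : ℕ → (ℕ → Series) → Series
ΣS zero    f = f 0
ΣS (suc n) f = ΣS n f ⊕ f (suc n)

ΣS-coeff : ∀ M f n → ΣS M f n ≡ Σ≤ M (λ k → f k n)
ΣS-coeff zero    f n = refl
ΣS-coeff (suc M) f n = cong (ℤ._+ f (suc M) n) (ΣS-coeff M f n)

module Identity (N : ℕ) where
  open Truncated N
  open SetoidReasoning setoid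
  open ℕSolver.+-*-Solver using () renaming (solve to ℕ-solve; _:=_ to _⊜_; _:+_ to _⊞_; _:*_ to _⊠_; con to κ)

  qˆ-⊗ : ∀ d e {m} → m ≡ d ℕ.+ e → qˆ m ≈ qˆ d ⊗ qˆ e
  qˆ-⊗ d e refl = ≈-sym (≗⇒≈ (qˆ-+ d e))

  qˆ-vanish : ∀ {d} → N < d → qˆ d ≈ 𝟘
  qˆ-vanish {d} N<d = mk λ n n≤N → qˆ-low d n (ℕₚ.≤-<-trans n≤N N<d)

  qˆ-⊗-vanish : ∀ {d} f → N < d → qˆ d ⊗ f ≈ 𝟘
  qˆ-⊗-vanish f N<d = ≈-trans (⊗-congʳ f (qˆ-vanish N<d)) (zeroˡ f)

  1+qˆ-vanish : ∀ {d} → N < d → 𝟙 ⊕ qˆ d ≈ 𝟙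
  1+qˆ-vanish N<d = ≈-trans (⊕-congˡ 𝟙 (qˆ-vanish N<d)) (+-identityʳ 𝟙)

  ⊗-cancelˡ : ∀ {f g h} → f 0 ≡ + 1 → f ⊗ g ≈ f ⊗ h → g ≈ h
  ⊗-cancelˡ {f} {g} {h} f0 eq = begin
    g                ≈⟨ strip g ⟩
    inv f ⊗ (f ⊗ g)  ≈⟨ ⊗-congˡ (inv f) eq ⟩
    inv f ⊗ (f ⊗ h)  ≈⟨ strip h ⟨
    h                ∎
    where
    strip : ∀ x → x ≈ inv f ⊗ (f ⊗ x)
    strip x = begin
      x                  ≈⟨ *-identityˡ x ⟨
      𝟙 ⊗ x              ≈⟨ ⊗-congʳ x (≗⇒≈ (⊗-inv f f0)) ⟨
      (f ⊗ inv f) ⊗ x    ≈⟨ solve 3 (λ f v x → (f :* v) :* x := v :* (f :* x)) ≈-refl f (inv f) x ⟩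
      inv f ⊗ (f ⊗ x)    ∎

  q²-power : ∀ n → q² ^ˢ n ≈ qˆ (2 ℕ.* n)
  q²-power zero    = ≈-sym (≗⇒≈ qˆ-0)
  q²-power (suc n) = ≈-trans (⊗-congʳ q² (q²-power n))
    (≈-sym (qˆ-⊗ (2 ℕ.* n) 2 (ℕ-solve 1 (λ n → κ 2 ⊠ (κ 1 ⊞ n) ⊜ κ 2 ⊠ n ⊞ κ 2) refl n)))

  q-power : ∀ n → q ^ˢ n ≈ qˆ n
  q-power zero    = ≈-sym (≗⇒≈ qˆ-0)
  q-power (suc n) = ≈-trans (⊗-congʳ q (q-power n)) (≈-sym (qˆ-⊗ n 1 (ℕₚ.+-comm 1 n)))

  pochFactor⁺ : ∀ e n → 𝟙 ⊕ ⊖ (⊖ qˆ e ⊗ q² ^ˢ n) ≈ 𝟙 ⊕ qˆ (e ℕ.+ 2 ℕ.* n)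
  pochFactor⁺ e n = begin
    𝟙 ⊕ ⊖ (⊖ qˆ e ⊗ q² ^ˢ n)        ≈⟨ ⊕-congˡ 𝟙 (⊖-cong (⊗-congˡ (⊖ qˆ e) (q²-power n))) ⟩
    𝟙 ⊕ ⊖ (⊖ qˆ e ⊗ qˆ (2 ℕ.* n))   ≈⟨ solve 2 (λ a b → one :+ :- (:- a :* b) := one :+ a :* b) ≈-refl (qˆ e) (qˆ (2 ℕ.* n)) ⟩
    𝟙 ⊕ qˆ e ⊗ qˆ (2 ℕ.* n)         ≈⟨ ⊕-congˡ 𝟙 (qˆ-⊗ e (2 ℕ.* n) refl) ⟨
    𝟙 ⊕ qˆ (e ℕ.+ 2 ℕ.* n)          ∎

  poch-last⁺ : ∀ e n → poch (⊖ qˆ e) q² (suc n) ≈ poch (⊖ qˆ e) q² n ⊗ (𝟙 ⊕ qˆ (e ℕ.+ 2 ℕ.* n))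
  poch-last⁺ e n = ⊗-congˡ (poch (⊖ qˆ e) q² n) (pochFactor⁺ e n)

  poch-q²-last : ∀ n → poch q² q² (suc n) ≈ poch q² q² n ⊗ (𝟙 ⊕ ⊖ qˆ (2 ℕ.+ 2 ℕ.* n))
  poch-q²-last n = ⊗-congˡ (poch q² q² n) (⊕-congˡ 𝟙 (⊖-cong
    (≈-trans (⊗-congˡ q² (q²-power n)) (≈-sym (qˆ-⊗ 2 (2 ℕ.* n) refl)))))

  poch-q-last : ∀ n → poch q q (suc n) ≈ poch q q n ⊗ (𝟙 ⊕ ⊖ qˆ (suc n))
  poch-q-last n = ⊗-congˡ (poch q q n) (⊕-congˡ 𝟙 (⊖-cong
    (≈-trans (⊗-congˡ q (q-power n)) (≈-sym (qˆ-⊗ 1 n refl)))))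

  -- `poch` grows at its last factor, but passing from (-q^e;q²)_∞ to (-q^(e+2);q²)_∞ removes the
  -- first one.
  poch-head⁺ : ∀ e n → poch (⊖ qˆ e) q² (suc n) ≈ (𝟙 ⊕ qˆ e) ⊗ poch (⊖ qˆ (2 ℕ.+ e)) q² n
  poch-head⁺ e zero = begin
    poch (⊖ qˆ e) q² 1              ≈⟨ poch-last⁺ e 0 ⟩
    𝟙 ⊗ (𝟙 ⊕ qˆ (e ℕ.+ 0))          ≡⟨ cong (λ d → 𝟙 ⊗ (𝟙 ⊕ qˆ d)) (ℕₚ.+-identityʳ e) ⟩
    𝟙 ⊗ (𝟙 ⊕ qˆ e)                  ≈⟨ *-comm 𝟙 (𝟙 ⊕ qˆ e) ⟩
    (𝟙 ⊕ qˆ e) ⊗ 𝟙                  ∎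
  poch-head⁺ e (suc n) = begin
    poch (⊖ qˆ e) q² (2 ℕ.+ n)
      ≈⟨ poch-last⁺ e (suc n) ⟩
    poch (⊖ qˆ e) q² (suc n) ⊗ (𝟙 ⊕ qˆ (e ℕ.+ 2 ℕ.* suc n))
      ≈⟨ ⊗-congʳ (𝟙 ⊕ qˆ (e ℕ.+ 2 ℕ.* suc n)) (poch-head⁺ e n) ⟩
    ((𝟙 ⊕ qˆ e) ⊗ p) ⊗ (𝟙 ⊕ qˆ (e ℕ.+ 2 ℕ.* suc n))
      ≡⟨ cong (λ d → ((𝟙 ⊕ qˆ e) ⊗ p) ⊗ (𝟙 ⊕ qˆ d)) (ℕ-solve 2 (λ e n → e ⊞ κ 2 ⊠ (κ 1 ⊞ n) ⊜ κ 2 ⊞ e ⊞ κ 2 ⊠ n) refl e n) ⟩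
    ((𝟙 ⊕ qˆ e) ⊗ p) ⊗ (𝟙 ⊕ qˆ (2 ℕ.+ e ℕ.+ 2 ℕ.* n))
      ≈⟨ *-assoc (𝟙 ⊕ qˆ e) p (𝟙 ⊕ qˆ (2 ℕ.+ e ℕ.+ 2 ℕ.* n)) ⟩
    (𝟙 ⊕ qˆ e) ⊗ (p ⊗ (𝟙 ⊕ qˆ (2 ℕ.+ e ℕ.+ 2 ℕ.* n)))
      ≈⟨ ⊗-congˡ (𝟙 ⊕ qˆ e) (poch-last⁺ (2 ℕ.+ e) n) ⟨
    (𝟙 ⊕ qˆ e) ⊗ poch (⊖ qˆ (2 ℕ.+ e)) q² (suc n) ∎
    where p = poch (⊖ qˆ (2 ℕ.+ e)) q² n

  -- (−q^e;q²)_∞: the factors left out are 1 modulo q^(N+1).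
  P : ℕ → Series
  P e = poch (⊖ qˆ e) q² (suc N)

  -- Both sides truncate after N + 1 factors, so the right one has a surplus last factor; its
  -- exponent 2 + e + 2N exceeds N.
  P-step : ∀ e → P e ≈ (𝟙 ⊕ qˆ e) ⊗ P (2 ℕ.+ e)
  P-step e = begin
    P e                                                ≈⟨ poch-head⁺ e N ⟩
    (𝟙 ⊕ qˆ e) ⊗ p                                     ≈⟨ ⊗-congˡ (𝟙 ⊕ qˆ e) (*-identityʳ p) ⟨
    (𝟙 ⊕ qˆ e) ⊗ (p ⊗ 𝟙)                               ≈⟨ ⊗-congˡ (𝟙 ⊕ qˆ e) (⊗-congˡ p (1+qˆ-vanish N<)) ⟨
    (𝟙 ⊕ qˆ e) ⊗ (p ⊗ (𝟙 ⊕ qˆ (2 ℕ.+ e ℕ.+ 2 ℕ.* N)))  ≈⟨ ⊗-congˡ (𝟙 ⊕ qˆ e) (poch-last⁺ (2 ℕ.+ e) N) ⟨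
    (𝟙 ⊕ qˆ e) ⊗ P (2 ℕ.+ e)                           ∎
    where
    p = poch (⊖ qˆ (2 ℕ.+ e)) q² N
    N< : N < 2 ℕ.+ e ℕ.+ 2 ℕ.* N
    N< = s≤s (ℕₚ.m≤n⇒m≤1+n (ℕₚ.≤-trans (ℕₚ.m≤m+n N _) (ℕₚ.m≤n+m (2 ℕ.* N) e)))

  P-split : ∀ e n → P e ≈ poch (⊖ qˆ e) q² n ⊗ P (e ℕ.+ 2 ℕ.* n)
  P-split e zero    = ≈-sym (≈-trans (*-identityˡ (P (e ℕ.+ 0))) (≈-reflexive (cong P (ℕₚ.+-identityʳ e))))
  P-split e (suc n) = begin
    P e                                                   ≈⟨ P-split e n ⟩
    p ⊗ P d                                               ≈⟨ ⊗-congˡ p (P-step d) ⟩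
    p ⊗ ((𝟙 ⊕ qˆ d) ⊗ P (2 ℕ.+ d))                        ≈⟨ *-assoc p (𝟙 ⊕ qˆ d) (P (2 ℕ.+ d)) ⟨
    (p ⊗ (𝟙 ⊕ qˆ d)) ⊗ P (2 ℕ.+ d)                        ≈⟨ ⊗-congʳ (P (2 ℕ.+ d)) (poch-last⁺ e n) ⟨
    poch (⊖ qˆ e) q² (suc n) ⊗ P (2 ℕ.+ d)                ≡⟨ cong (λ m → poch (⊖ qˆ e) q² (suc n) ⊗ P m)
                                                              (ℕ-solve 2 (λ e n → κ 2 ⊞ (e ⊞ κ 2 ⊠ n) ⊜ e ⊞ κ 2 ⊠ (κ 1 ⊞ n)) refl e n) ⟩
    poch (⊖ qˆ e) q² (suc n) ⊗ P (e ℕ.+ 2 ℕ.* suc n)      ∎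
    where
    p = poch (⊖ qˆ e) q² n
    d = e ℕ.+ 2 ℕ.* n

  P-vanish : ∀ {e} → N < e → P e ≈ 𝟙
  P-vanish {e} N<e = go (suc N)
    where
    go : ∀ n → poch (⊖ qˆ e) q² n ≈ 𝟙
    go zero    = ≈-refl
    go (suc n) = ≈-trans (poch-last⁺ e n) (≈-trans
      (⊗-cong (go n) (1+qˆ-vanish (ℕₚ.<-≤-trans N<e (ℕₚ.m≤m+n e _)))) (*-identityˡ 𝟙))

  -- What is left of a summand, apart from its power of q, once its denominator (-q³;q²)_n has been
  -- absorbed into the infinite product.
  ratio : ℕ → Series
  ratio n = poch (⊖ qˆ 2) q² n ⊗ inv (poch q² q² n)

  -- The quotient of consecutive ratios, cross-multiplied so that no further inverse appears.
  ratio-step : ∀ n → (𝟙 ⊕ ⊖ qˆ (2 ℕ.+ 2 ℕ.* n)) ⊗ ratio (suc n) ≈ (𝟙 ⊕ qˆ (2 ℕ.+ 2 ℕ.* n)) ⊗ ratio n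
  ratio-step n = ⊗-cancelˡ {p} (poch-const-term q² q² n refl) (begin
    p ⊗ ((𝟙 ⊕ ⊖ x) ⊗ (poch (⊖ qˆ 2) q² (suc n) ⊗ v′))
      ≈⟨ ⊗-congˡ p (⊗-congˡ (𝟙 ⊕ ⊖ x) (⊗-congʳ v′ (poch-last⁺ 2 n))) ⟩
    p ⊗ ((𝟙 ⊕ ⊖ x) ⊗ ((w ⊗ (𝟙 ⊕ x)) ⊗ v′))
      ≈⟨ solve 4 (λ p x w v′ → p :* ((one :+ :- x) :* ((w :* (one :+ x)) :* v′)) := (w :* (one :+ x)) :* ((p :* (one :+ :- x)) :* v′)) ≈-refl p x w v′ ⟩
    (w ⊗ (𝟙 ⊕ x)) ⊗ ((p ⊗ (𝟙 ⊕ ⊖ x)) ⊗ v′)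
      ≈⟨ ⊗-congˡ (w ⊗ (𝟙 ⊕ x)) (⊗-congʳ v′ (poch-q²-last n)) ⟨
    (w ⊗ (𝟙 ⊕ x)) ⊗ (p′ ⊗ v′)
      ≈⟨ ⊗-congˡ (w ⊗ (𝟙 ⊕ x)) (≗⇒≈ (⊗-inv p′ (poch-const-term q² q² (suc n) refl))) ⟩
    (w ⊗ (𝟙 ⊕ x)) ⊗ 𝟙
      ≈⟨ ⊗-congˡ (w ⊗ (𝟙 ⊕ x)) (≗⇒≈ (⊗-inv p (poch-const-term q² q² n refl))) ⟨
    (w ⊗ (𝟙 ⊕ x)) ⊗ (p ⊗ v)
      ≈⟨ solve 4 (λ p x w v → (w :* (one :+ x)) :* (p :* v) := p :* ((one :+ x) :* (w :* v))) ≈-refl p x w v ⟩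
    p ⊗ ((𝟙 ⊕ x) ⊗ (w ⊗ v)) ∎)
    where
    p  = poch q² q² n
    p′ = poch q² q² (suc n)
    v  = inv p
    v′ = inv p′
    w  = poch (⊖ qˆ 2) q² n
    x  = qˆ (2 ℕ.+ 2 ℕ.* n)

-- The telescoping sums

module Sums (N : ℕ) where
  open Truncated N
  open Identity N
  open SetoidReasoning setoid
  open ℕSolver.+-*-Solver using () renaming (solve to ℕ-solve; _:=_ to _⊜_; _:+_ to _⊞_; _:*_ to _⊠_; con to κ)

  y : Series
  y = qˆ 1

  -- This is Q^(j+1): the index is one less than k in the overview, as for `H`. Thus `α j` and `β j`
  -- are the coefficients of the recurrence at k = j + 1.
  z : ℕ → Series
  z j = qˆ (2 ℕ.+ 2 ℕ.* j)

  α β : ℕ → Series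
  α j = 𝟙 ⊕ z j ⊕ y ⊗ z j
  β j = (z j ⊗ (y ⊗ y)) ⊗ (𝟙 ⊕ ⊖ (y ⊗ z j))

  -- Twice kn + n(n-1)/2 at k = j + 1, the exponent being counted in q and not in Q.
  expo : ℕ → ℕ → ℕ
  expo n j = n ℕ.* suc n ℕ.+ 2 ℕ.* (j ℕ.* n)

  -- t n j is the n-th term of H j, and R the certificate by which the terms of H-rec telescope.
  t R : ℕ → ℕ → Series
  t n j = qˆ (expo n j) ⊗ (ratio n ⊗ P (3 ℕ.+ 2 ℕ.* n ℕ.+ 2 ℕ.* j))
  R n j = qˆ (expo n j) ⊗ ((𝟙 ⊕ ⊖ qˆ (2 ℕ.* n)) ⊗ (ratio n ⊗ P (5 ℕ.+ 2 ℕ.* n ℕ.+ 2 ℕ.* j)))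

  module _ (n j : ℕ) where
    private
      e = qˆ (expo n j)
      x = qˆ (2 ℕ.* n)
      c = ratio n
      -- The infinite product with the fewest factors among those that occur, namely that of
      -- `t n (2 + j)` and `R (1 + n) j`; the others are polynomial multiples of it.
      p = P (7 ℕ.+ 2 ℕ.* n ℕ.+ 2 ℕ.* j)

      qˆ3 : qˆ (3 ℕ.+ 2 ℕ.* n ℕ.+ 2 ℕ.* j) ≈ y ⊗ (z j ⊗ x)
      qˆ3 = ≈-trans (qˆ-⊗ 1 (2 ℕ.+ 2 ℕ.* j ℕ.+ 2 ℕ.* n)
          (ℕ-solve 2 (λ n j → κ 3 ⊞ κ 2 ⊠ n ⊞ κ 2 ⊠ j ⊜ κ 1 ⊞ (κ 2 ⊞ κ 2 ⊠ j ⊞ κ 2 ⊠ n)) refl n j))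
        (⊗-congˡ y (qˆ-⊗ (2 ℕ.+ 2 ℕ.* j) (2 ℕ.* n) refl))

      qˆ5 : qˆ (5 ℕ.+ 2 ℕ.* n ℕ.+ 2 ℕ.* j) ≈ (y ⊗ y) ⊗ (y ⊗ (z j ⊗ x))
      qˆ5 = ≈-trans (qˆ-⊗ 2 (3 ℕ.+ 2 ℕ.* n ℕ.+ 2 ℕ.* j) refl) (⊗-cong (qˆ-⊗ 1 1 refl) qˆ3)

      P5 : P (5 ℕ.+ 2 ℕ.* n ℕ.+ 2 ℕ.* j) ≈ (𝟙 ⊕ (y ⊗ y) ⊗ (y ⊗ (z j ⊗ x))) ⊗ p
      P5 = ≈-trans (P-step (5 ℕ.+ 2 ℕ.* n ℕ.+ 2 ℕ.* j)) (⊗-congʳ p (⊕-congˡ 𝟙 qˆ5))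

      P3 : P (3 ℕ.+ 2 ℕ.* n ℕ.+ 2 ℕ.* j) ≈ (𝟙 ⊕ y ⊗ (z j ⊗ x)) ⊗ ((𝟙 ⊕ (y ⊗ y) ⊗ (y ⊗ (z j ⊗ x))) ⊗ p)
      P3 = ≈-trans (P-step (3 ℕ.+ 2 ℕ.* n ℕ.+ 2 ℕ.* j)) (⊗-cong (⊕-congˡ 𝟙 qˆ3) P5)

      t₀ : t n j ≈ e ⊗ (c ⊗ ((𝟙 ⊕ y ⊗ (z j ⊗ x)) ⊗ ((𝟙 ⊕ (y ⊗ y) ⊗ (y ⊗ (z j ⊗ x))) ⊗ p)))
      t₀ = ⊗-congˡ e (⊗-congˡ c P3)

      t₁ : t n (1 ℕ.+ j) ≈ (e ⊗ x) ⊗ (c ⊗ ((𝟙 ⊕ (y ⊗ y) ⊗ (y ⊗ (z j ⊗ x))) ⊗ p))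
      t₁ = ⊗-cong
        (qˆ-⊗ (expo n j) (2 ℕ.* n)
          (ℕ-solve 2 (λ n j → n ⊠ (κ 1 ⊞ n) ⊞ κ 2 ⊠ ((κ 1 ⊞ j) ⊠ n) ⊜ n ⊠ (κ 1 ⊞ n) ⊞ κ 2 ⊠ (j ⊠ n) ⊞ κ 2 ⊠ n) refl n j))
        (⊗-congˡ c (≈-trans (≈-reflexive (cong P
          (ℕ-solve 2 (λ n j → κ 3 ⊞ κ 2 ⊠ n ⊞ κ 2 ⊠ (κ 1 ⊞ j) ⊜ κ 5 ⊞ κ 2 ⊠ n ⊞ κ 2 ⊠ j) refl n j))) P5))

      t₂ : t n (2 ℕ.+ j) ≈ ((e ⊗ x) ⊗ x) ⊗ (c ⊗ p)
      t₂ = ⊗-cong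
        (≈-trans (qˆ-⊗ (expo n j ℕ.+ 2 ℕ.* n) (2 ℕ.* n)
          (ℕ-solve 2 (λ n j → n ⊠ (κ 1 ⊞ n) ⊞ κ 2 ⊠ ((κ 2 ⊞ j) ⊠ n) ⊜ n ⊠ (κ 1 ⊞ n) ⊞ κ 2 ⊠ (j ⊠ n) ⊞ κ 2 ⊠ n ⊞ κ 2 ⊠ n) refl n j))
          (⊗-congʳ x (qˆ-⊗ (expo n j) (2 ℕ.* n) refl)))
        (⊗-congˡ c (≈-reflexive (cong P
          (ℕ-solve 2 (λ n j → κ 3 ⊞ κ 2 ⊠ n ⊞ κ 2 ⊠ (κ 2 ⊞ j) ⊜ κ 7 ⊞ κ 2 ⊠ n ⊞ κ 2 ⊠ j) refl n j))))

      R₀ : R n j ≈ e ⊗ ((𝟙 ⊕ ⊖ x) ⊗ (c ⊗ ((𝟙 ⊕ (y ⊗ y) ⊗ (y ⊗ (z j ⊗ x))) ⊗ p)))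
      R₀ = ⊗-congˡ e (⊗-congˡ (𝟙 ⊕ ⊖ x) (⊗-congˡ c P5))

    -- The factor 1 - Q^(n+1) of the certificate cancels the newest denominator of `ratio (suc n)`,
    -- so this term too is a polynomial multiple of `ratio n`.
    R₁ : R (1 ℕ.+ n) j ≈ (e ⊗ (z j ⊗ x)) ⊗ ((𝟙 ⊕ (y ⊗ y) ⊗ x) ⊗ (c ⊗ p))
    R₁ = ⊗-cong
      (≈-trans (qˆ-⊗ (expo n j) (2 ℕ.+ 2 ℕ.* j ℕ.+ 2 ℕ.* n)
          (ℕ-solve 2 (λ n j → (κ 1 ⊞ n) ⊠ (κ 2 ⊞ n) ⊞ κ 2 ⊠ (j ⊠ (κ 1 ⊞ n)) ⊜
            n ⊠ (κ 1 ⊞ n) ⊞ κ 2 ⊠ (j ⊠ n) ⊞ (κ 2 ⊞ κ 2 ⊠ j ⊞ κ 2 ⊠ n)) refl n j))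
        (⊗-congˡ e (qˆ-⊗ (2 ℕ.+ 2 ℕ.* j) (2 ℕ.* n) refl)))
      (begin
        (𝟙 ⊕ ⊖ qˆ (2 ℕ.* suc n)) ⊗ (ratio (suc n) ⊗ P (5 ℕ.+ 2 ℕ.* suc n ℕ.+ 2 ℕ.* j))
          ≡⟨ cong₂ (λ a b → (𝟙 ⊕ ⊖ qˆ a) ⊗ (ratio (suc n) ⊗ P b))
               (ℕ-solve 1 (λ n → κ 2 ⊠ (κ 1 ⊞ n) ⊜ κ 2 ⊞ κ 2 ⊠ n) refl n)
               (ℕ-solve 2 (λ n j → κ 5 ⊞ κ 2 ⊠ (κ 1 ⊞ n) ⊞ κ 2 ⊠ j ⊜ κ 7 ⊞ κ 2 ⊠ n ⊞ κ 2 ⊠ j) refl n j) ⟩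
        (𝟙 ⊕ ⊖ x′) ⊗ (ratio (suc n) ⊗ p)
          ≈⟨ *-assoc (𝟙 ⊕ ⊖ x′) (ratio (suc n)) p ⟨
        ((𝟙 ⊕ ⊖ x′) ⊗ ratio (suc n)) ⊗ p
          ≈⟨ ⊗-congʳ p (ratio-step n) ⟩
        ((𝟙 ⊕ x′) ⊗ c) ⊗ p
          ≈⟨ *-assoc (𝟙 ⊕ x′) c p ⟩
        (𝟙 ⊕ x′) ⊗ (c ⊗ p)
          ≈⟨ ⊗-congʳ (c ⊗ p) (⊕-congˡ 𝟙 (≈-trans (qˆ-⊗ 2 (2 ℕ.* n) refl) (⊗-congʳ x (qˆ-⊗ 1 1 refl)))) ⟩
        (𝟙 ⊕ (y ⊗ y) ⊗ x) ⊗ (c ⊗ p) ∎)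
      where x′ = qˆ (2 ℕ.+ 2 ℕ.* n)

    -- After the common factors `e`, `c` and `p` are taken out, a polynomial identity in q, Q^(j+1)
    -- and Q^n remains.
    telescope : t n j ⊕ R (1 ℕ.+ n) j ≈ (α j ⊗ t n (1 ℕ.+ j) ⊕ β j ⊗ t n (2 ℕ.+ j)) ⊕ R n j
    telescope = begin
      t n j ⊕ R (1 ℕ.+ n) j
        ≈⟨ ⊕-cong t₀ R₁ ⟩
      e ⊗ (c ⊗ ((𝟙 ⊕ y ⊗ (z j ⊗ x)) ⊗ ((𝟙 ⊕ (y ⊗ y) ⊗ (y ⊗ (z j ⊗ x))) ⊗ p)))
        ⊕ (e ⊗ (z j ⊗ x)) ⊗ ((𝟙 ⊕ (y ⊗ y) ⊗ x) ⊗ (c ⊗ p))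
        ≈⟨ solve 6 (λ e x c p y z →
             e :* (c :* ((one :+ y :* (z :* x)) :* ((one :+ (y :* y) :* (y :* (z :* x))) :* p)))
               :+ (e :* (z :* x)) :* ((one :+ (y :* y) :* x) :* (c :* p))
             := ((one :+ z :+ y :* z) :* ((e :* x) :* (c :* ((one :+ (y :* y) :* (y :* (z :* x))) :* p)))
               :+ ((z :* (y :* y)) :* (one :+ :- (y :* z))) :* (((e :* x) :* x) :* (c :* p)))
               :+ e :* ((one :+ :- x) :* (c :* ((one :+ (y :* y) :* (y :* (z :* x))) :* p))))
             ≈-refl e x c p y (z j) ⟩
      (α j ⊗ ((e ⊗ x) ⊗ (c ⊗ ((𝟙 ⊕ (y ⊗ y) ⊗ (y ⊗ (z j ⊗ x))) ⊗ p)))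
        ⊕ β j ⊗ (((e ⊗ x) ⊗ x) ⊗ (c ⊗ p)))
        ⊕ e ⊗ ((𝟙 ⊕ ⊖ x) ⊗ (c ⊗ ((𝟙 ⊕ (y ⊗ y) ⊗ (y ⊗ (z j ⊗ x))) ⊗ p)))
        ≈⟨ ⊕-cong (⊕-cong (⊗-congˡ (α j) t₁) (⊗-congˡ (β j) t₂)) R₀ ⟨
      (α j ⊗ t n (1 ℕ.+ j) ⊕ β j ⊗ t n (2 ℕ.+ j)) ⊕ R n j ∎

  R-zero : ∀ j → R 0 j ≈ 𝟘
  R-zero j = begin
    qˆ (expo 0 j) ⊗ ((𝟙 ⊕ ⊖ qˆ 0) ⊗ u)  ≈⟨ ⊗-congˡ (qˆ (expo 0 j)) (⊗-congʳ u (⊕-congˡ 𝟙 (⊖-cong (≗⇒≈ qˆ-0)))) ⟩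
    qˆ (expo 0 j) ⊗ ((𝟙 ⊕ ⊖ 𝟙) ⊗ u)     ≈⟨ ⊗-congˡ (qˆ (expo 0 j)) (⊗-congʳ u (≗⇒≈ λ n → ℤₚ.+-inverseʳ (𝟙 n))) ⟩
    qˆ (expo 0 j) ⊗ (𝟘 ⊗ u)             ≈⟨ ⊗-congˡ (qˆ (expo 0 j)) (zeroˡ u) ⟩
    qˆ (expo 0 j) ⊗ 𝟘                   ≈⟨ ≈-trans (*-comm (qˆ (expo 0 j)) 𝟘) (zeroˡ (qˆ (expo 0 j))) ⟩
    𝟘                                   ∎
    where u = ratio 0 ⊗ P (5 ℕ.+ 2 ℕ.* 0 ℕ.+ 2 ℕ.* j)

  telescope-sum : ∀ M j → ΣS M (λ n → t n j) ⊕ R (suc M) j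
    ≈ α j ⊗ ΣS M (λ n → t n (1 ℕ.+ j)) ⊕ β j ⊗ ΣS M (λ n → t n (2 ℕ.+ j))
  telescope-sum zero    j = ≈-trans (telescope 0 j)
    (≈-trans (⊕-congˡ (α j ⊗ t 0 (1 ℕ.+ j) ⊕ β j ⊗ t 0 (2 ℕ.+ j)) (R-zero j))
      (+-identityʳ (α j ⊗ t 0 (1 ℕ.+ j) ⊕ β j ⊗ t 0 (2 ℕ.+ j))))
  telescope-sum (suc M) j = begin
    (S₀ ⊕ u₀) ⊕ R (2 ℕ.+ M) j
      ≈⟨ solve 3 (λ S u r → (S :+ u) :+ r := S :+ (u :+ r)) ≈-refl S₀ u₀ (R (2 ℕ.+ M) j) ⟩
    S₀ ⊕ (u₀ ⊕ R (2 ℕ.+ M) j)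
      ≈⟨ ⊕-congˡ S₀ (telescope (suc M) j) ⟩
    S₀ ⊕ ((α j ⊗ u₁ ⊕ β j ⊗ u₂) ⊕ R (suc M) j)
      ≈⟨ solve 6 (λ S a b u v r → S :+ ((a :* u :+ b :* v) :+ r) := (S :+ r) :+ (a :* u :+ b :* v)) ≈-refl S₀ (α j) (β j) u₁ u₂ (R (suc M) j) ⟩
    (S₀ ⊕ R (suc M) j) ⊕ (α j ⊗ u₁ ⊕ β j ⊗ u₂)
      ≈⟨ ⊕-congʳ (α j ⊗ u₁ ⊕ β j ⊗ u₂) (telescope-sum M j) ⟩
    (α j ⊗ S₁ ⊕ β j ⊗ S₂) ⊕ (α j ⊗ u₁ ⊕ β j ⊗ u₂)
      ≈⟨ solve 6 (λ a b S T u v → (a :* S :+ b :* T) :+ (a :* u :+ b :* v) := a :* (S :+ u) :+ b :* (T :+ v)) ≈-refl (α j) (β j) S₁ S₂ u₁ u₂ ⟩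
    α j ⊗ (S₁ ⊕ u₁) ⊕ β j ⊗ (S₂ ⊕ u₂) ∎
    where
    S₀ = ΣS M (λ n → t n j)
    S₁ = ΣS M (λ n → t n (1 ℕ.+ j))
    S₂ = ΣS M (λ n → t n (2 ℕ.+ j))
    u₀ = t (suc M) j
    u₁ = t (suc M) (1 ℕ.+ j)
    u₂ = t (suc M) (2 ℕ.+ j)

  -- H j is H_{j+1} of the header: j = 0 gives the sum in rhs times (−q³;q²)_∞.
  H : ℕ → Series
  H j = ΣS N (λ n → t n j)

  N<expo : ∀ j → N < expo (suc N) j
  N<expo j = ℕₚ.≤-trans (ℕₚ.m≤m*n (suc N) (2 ℕ.+ N)) (ℕₚ.m≤m+n _ _)

  -- Of the two boundary terms, `R 0 j` contains the factor 1 - Q^0 and `R (suc N) j` a power of q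
  -- beyond N.
  H-rec : ∀ j → H j ≈ α j ⊗ H (1 ℕ.+ j) ⊕ β j ⊗ H (2 ℕ.+ j)
  H-rec j = begin
    H j                   ≈⟨ +-identityʳ (H j) ⟨
    H j ⊕ 𝟘               ≈⟨ ⊕-congˡ (H j) (qˆ-⊗-vanish (u (suc N)) (N<expo j)) ⟨
    H j ⊕ R (suc N) j     ≈⟨ telescope-sum N j ⟩
    α j ⊗ H (1 ℕ.+ j) ⊕ β j ⊗ H (2 ℕ.+ j) ∎
    where
    u : ℕ → Series
    u n = (𝟙 ⊕ ⊖ qˆ (2 ℕ.* n)) ⊗ (ratio n ⊗ P (5 ℕ.+ 2 ℕ.* n ℕ.+ 2 ℕ.* j))

  t-zero : ∀ j → N < 2 ℕ.+ 2 ℕ.* j → t 0 j ≈ 𝟙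
  t-zero j N< = begin
    qˆ (expo 0 j) ⊗ (ratio 0 ⊗ P (3 ℕ.+ 2 ℕ.* j))   ≡⟨ cong (λ d → qˆ d ⊗ (ratio 0 ⊗ P (3 ℕ.+ 2 ℕ.* j))) (cong (2 ℕ.*_) (ℕₚ.*-zeroʳ j)) ⟩
    qˆ 0 ⊗ (ratio 0 ⊗ P (3 ℕ.+ 2 ℕ.* j))            ≈⟨ ⊗-cong (≗⇒≈ qˆ-0) (⊗-cong (≗⇒≈ (⊗-inv 𝟙 refl)) (P-vanish (ℕₚ.m<n⇒m<1+n N<))) ⟩
    𝟙 ⊗ (𝟙 ⊗ 𝟙)                                     ≈⟨ ≈-trans (*-identityˡ (𝟙 ⊗ 𝟙)) (*-identityˡ 𝟙) ⟩
    𝟙                                               ∎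

  -- The finite form of H_k → 1: terms with n ≥ 1 carry at least q^(2+2j), and the term n = 0 is an
  -- infinite product whose factors differ from 1 by even higher powers.
  H-vanish : ∀ j → N < 2 ℕ.+ 2 ℕ.* j → H j ≈ 𝟙
  H-vanish j N< = go N
    where
    expo≥ : ∀ n → 2 ℕ.+ 2 ℕ.* j ≤ expo (suc n) j
    expo≥ n = ℕₚ.+-mono-≤ (ℕₚ.*-mono-≤ (s≤s (z≤n {n})) (s≤s (s≤s (z≤n {n})))) (ℕₚ.*-monoʳ-≤ 2 (ℕₚ.m≤m*n j (suc n)))
    go : ∀ M → ΣS M (λ n → t n j) ≈ 𝟙
    go zero    = t-zero j N<
    go (suc M) = ≈-trans (⊕-cong (go M) (qˆ-⊗-vanish (ratio (suc M) ⊗ P (3 ℕ.+ 2 ℕ.* suc M ℕ.+ 2 ℕ.* j)) (ℕₚ.<-≤-trans N< (expo≥ M)))) (+-identityʳ 𝟙)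

  -- The invariant and its limit

  module Limit (b w : ℕ → Series)
    (b-zero : b 0 ≈ 𝟙 ⊕ y ⊗ y ⊕ y ⊗ (y ⊗ y))
    (w-zero : w 0 ≈ 𝟙 ⊕ 𝟙 ⊕ y ⊗ y)
    (b-suc  : ∀ i → b (suc i) ≈ (𝟙 ⊕ y ⊗ z (suc i)) ⊗ b i ⊕ z (suc i) ⊗ w i)
    (w-suc  : ∀ i → w (suc i) ≈ b i ⊕ b i ⊕ z (suc i) ⊗ w i)
    where

    -- The invariant of the overview at m = i + 2.
    L : ℕ → Series
    L i = (H (1 ℕ.+ i) ⊕ ⊖ (z (1 ℕ.+ i) ⊗ H (2 ℕ.+ i))) ⊗ b i ⊕ (z (1 ℕ.+ i) ⊗ H (2 ℕ.+ i)) ⊗ w i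

    z-suc : ∀ j → z (suc j) ≈ z j ⊗ (y ⊗ y)
    z-suc j = ≈-trans (qˆ-⊗ (2 ℕ.+ 2 ℕ.* j) 2 (ℕ-solve 1 (λ j → κ 2 ⊞ κ 2 ⊠ (κ 1 ⊞ j) ⊜ κ 2 ⊞ κ 2 ⊠ j ⊞ κ 2) refl j))
      (⊗-congˡ (z j) (qˆ-⊗ 1 1 refl))

    -- This is `H-rec 0` in disguise, because `b 0` equals `α 0` and `z 1` times the difference of
    -- `w 0` and `b 0` equals `β 0`.
    L-zero : L 0 ≈ H 0
    L-zero = begin
      (H 1 ⊕ ⊖ (z 1 ⊗ H 2)) ⊗ b 0 ⊕ (z 1 ⊗ H 2) ⊗ w 0
        ≈⟨ ⊕-cong (⊗-cong (⊕-congˡ (H 1) (⊖-cong zH)) b-zero) (⊗-cong zH w-zero) ⟩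
      (H 1 ⊕ ⊖ (((y ⊗ y) ⊗ (y ⊗ y)) ⊗ H 2)) ⊗ (𝟙 ⊕ y ⊗ y ⊕ y ⊗ (y ⊗ y)) ⊕ (((y ⊗ y) ⊗ (y ⊗ y)) ⊗ H 2) ⊗ (𝟙 ⊕ 𝟙 ⊕ y ⊗ y)
        ≈⟨ solve 3 (λ h k y →
             (h :+ :- (((y :* y) :* (y :* y)) :* k)) :* (one :+ y :* y :+ y :* (y :* y)) :+ (((y :* y) :* (y :* y)) :* k) :* (one :+ one :+ y :* y)
             := (one :+ y :* y :+ y :* (y :* y)) :* h :+ (((y :* y) :* (y :* y)) :* (one :+ :- (y :* (y :* y)))) :* k)
           ≈-refl (H 1) (H 2) y ⟩
      (𝟙 ⊕ y ⊗ y ⊕ y ⊗ (y ⊗ y)) ⊗ H 1 ⊕ (((y ⊗ y) ⊗ (y ⊗ y)) ⊗ (𝟙 ⊕ ⊖ (y ⊗ (y ⊗ y)))) ⊗ H 2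
        ≈⟨ ⊕-cong
             (⊗-congʳ (H 1) (⊕-cong (⊕-congˡ 𝟙 z0) (⊗-congˡ y z0)))
             (⊗-congʳ (H 2) (⊗-cong (⊗-congʳ (y ⊗ y) z0) (⊕-congˡ 𝟙 (⊖-cong (⊗-congˡ y z0))))) ⟨
      α 0 ⊗ H 1 ⊕ β 0 ⊗ H 2
        ≈⟨ H-rec 0 ⟨
      H 0 ∎
      where
      z0 : z 0 ≈ y ⊗ y
      z0 = qˆ-⊗ 1 1 refl
      zH : z 1 ⊗ H 2 ≈ ((y ⊗ y) ⊗ (y ⊗ y)) ⊗ H 2
      zH = ⊗-congʳ (H 2) (≈-trans (z-suc 0) (⊗-congʳ (y ⊗ y) z0))

    -- Once the recurrences are inserted, the coefficient of `w i` collapses to ζ H_(i+2+1) by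
    -- cancellation, and that of `b i` becomes the right side of `H-rec (suc i)` minus the same
    -- product.
    L-suc : ∀ i → L (suc i) ≈ L i
    L-suc i = begin
      (h₂ ⊕ ⊖ (z (2 ℕ.+ i) ⊗ h₃)) ⊗ b (suc i) ⊕ (z (2 ℕ.+ i) ⊗ h₃) ⊗ w (suc i)
        ≈⟨ ⊕-cong (⊗-cong (⊕-congˡ h₂ (⊖-cong zh)) (b-suc i)) (⊗-cong zh (w-suc i)) ⟩
      (h₂ ⊕ ⊖ ((ζ ⊗ (y ⊗ y)) ⊗ h₃)) ⊗ ((𝟙 ⊕ y ⊗ ζ) ⊗ b i ⊕ ζ ⊗ w i) ⊕ ((ζ ⊗ (y ⊗ y)) ⊗ h₃) ⊗ (b i ⊕ b i ⊕ ζ ⊗ w i)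
        ≈⟨ solve 6 (λ h k ζ y b w →
             (h :+ :- ((ζ :* (y :* y)) :* k)) :* ((one :+ y :* ζ) :* b :+ ζ :* w) :+ ((ζ :* (y :* y)) :* k) :* (b :+ b :+ ζ :* w)
             := ((((one :+ ζ :+ y :* ζ) :* h :+ ((ζ :* (y :* y)) :* (one :+ :- (y :* ζ))) :* k) :+ :- (ζ :* h)) :* b) :+ (ζ :* h) :* w)
           ≈-refl h₂ h₃ ζ y (b i) (w i) ⟩
      ((α (suc i) ⊗ h₂ ⊕ β (suc i) ⊗ h₃) ⊕ ⊖ (ζ ⊗ h₂)) ⊗ b i ⊕ (ζ ⊗ h₂) ⊗ w i
        ≈⟨ ⊕-congʳ ((ζ ⊗ h₂) ⊗ w i) (⊗-congʳ (b i) (⊕-congʳ (⊖ (ζ ⊗ h₂)) (H-rec (suc i)))) ⟨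
      L i ∎
      where
      h₂ = H (2 ℕ.+ i)
      h₃ = H (3 ℕ.+ i)
      ζ  = z (1 ℕ.+ i)
      zh : z (2 ℕ.+ i) ⊗ h₃ ≈ (ζ ⊗ (y ⊗ y)) ⊗ h₃
      zh = ⊗-congʳ h₃ (z-suc (1 ℕ.+ i))

    L-const : ∀ i → L i ≈ H 0
    L-const zero    = L-zero
    L-const (suc i) = ≈-trans (L-suc i) (L-const i)

    -- The limit is attained at `i = N`: there `z (1 + N)` is already 0 and `H (1 + N)` is 1.
    limit : b N ≈ H 0
    limit = begin
      b N
        ≈⟨ solve 2 (λ b w → b := (one :+ :- con (+ 0)) :* b :+ con (+ 0) :* w) ≈-refl (b N) (w N) ⟩
      (𝟙 ⊕ ⊖ 𝟘) ⊗ b N ⊕ 𝟘 ⊗ w N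
        ≈⟨ ⊕-cong (⊗-congʳ (b N) (⊕-cong (H-vanish (1 ℕ.+ N) N<) (⊖-cong zH))) (⊗-congʳ (w N) zH) ⟨
      L N
        ≈⟨ L-const N ⟩
      H 0 ∎
      where
      N< : N < 2 ℕ.+ 2 ℕ.* (1 ℕ.+ N)
      N< = s≤s (ℕₚ.m≤n⇒m≤1+n (ℕₚ.≤-trans (ℕₚ.n≤1+n N) (ℕₚ.m≤m+n (suc N) _)))
      zH : z (1 ℕ.+ N) ⊗ H (2 ℕ.+ N) ≈ 𝟘
      zH = qˆ-⊗-vanish (H (2 ℕ.+ N)) N<

-- The right-hand side

Σ≤-extend : ∀ {n M} (f : ℕ → ℤ) → n ≤ M → (∀ k → n < k → f k ≡ + 0) → Σ≤ M f ≡ Σ≤ n f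
Σ≤-extend {n} {M} f n≤M f0 = go (ℕₚ.≤⇒≤′ n≤M)
  where
  go : ∀ {M} → n ℕ.≤′ M → Σ≤ M f ≡ Σ≤ n f
  go ℕ.≤′-refl            = refl
  go (ℕ.≤′-step {M} n≤′M) =
    trans (cong₂ ℤ._+_ (go n≤′M) (f0 (suc M) (s≤s (ℕₚ.≤′⇒≤ n≤′M)))) (ℤₚ.+-identityʳ (Σ≤ n f))

n≤n*[1+n] : ∀ n → n ≤ n ℕ.* suc n
n≤n*[1+n] n = ℕₚ.m≤m*n n (suc n)

module Stable (N : ℕ) where
  open Truncated N
  open Identity N

  poch-q²-stable : ∀ e {M} → N ≤ M → poch (⊖ qˆ e) q² (suc M) ≈ poch (⊖ qˆ e) q² (suc N)
  poch-q²-stable e {M} N≤M = go (ℕₚ.≤⇒≤′ N≤M)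
    where
    go : ∀ {M} → N ℕ.≤′ M → poch (⊖ qˆ e) q² (suc M) ≈ poch (⊖ qˆ e) q² (suc N)
    go ℕ.≤′-refl            = ≈-refl
    go (ℕ.≤′-step {M} N≤′M) = ≈-trans (poch-last⁺ e (suc M)) (≈-trans
      (⊗-cong (go N≤′M) (1+qˆ-vanish N<)) (*-identityʳ (poch (⊖ qˆ e) q² (suc N))))
      where
      N< : N < e ℕ.+ 2 ℕ.* suc M
      N< = ℕₚ.≤-trans (s≤s (ℕₚ.≤′⇒≤ N≤′M)) (ℕₚ.≤-trans (ℕₚ.m≤m+n (suc M) _) (ℕₚ.m≤n+m (2 ℕ.* suc M) e))

  poch-q-stable : ∀ {M} → N ≤ M → poch q q M ≈ poch q q N
  poch-q-stable {M} N≤M = go (ℕₚ.≤⇒≤′ N≤M)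
    where
    go : ∀ {M} → N ℕ.≤′ M → poch q q M ≈ poch q q N
    go ℕ.≤′-refl            = ≈-refl
    go (ℕ.≤′-step {M} N≤′M) = ≈-trans (poch-q-last M) (≈-trans
      (⊗-cong (go N≤′M) (≈-trans (⊕-congˡ 𝟙 (⊖-cong (qˆ-vanish (s≤s (ℕₚ.≤′⇒≤ N≤′M)))))
        (≗⇒≈ λ n → ℤₚ.+-identityʳ (𝟙 n))))
      (*-identityʳ (poch q q N)))

  summand-vanish : ∀ {k} → N < k → summand k ≈ 𝟘
  summand-vanish {k} N<k = ≈-trans
    (⊗-congʳ v (qˆ-⊗-vanish (poch (⊖ qˆ 2) q² k) (ℕₚ.<-≤-trans N<k (n≤n*[1+n] k)))) (zeroˡ v)
    where v = inv (poch (⊖ qˆ 3) q² k ⊗ poch q² q² k)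

module RightSide (N : ℕ) where
  open Truncated N
  open Identity N
  open Sums N
  open SetoidReasoning setoid

  -- Coefficient `n` of `sumSeries` stops at the summand `n`, and the infinite products likewise use
  -- a number of factors depending on `n`. So each coefficient is compared modulo its own q^(n+1),
  -- using `Stable` at `n`.
  sumSeries≈ : sumSeries ≈ ΣS N summand
  sumSeries≈ = mk λ n n≤N → sym (trans (ΣS-coeff N summand n)
    (Σ≤-extend (λ k → summand k n) n≤N λ k n<k → coeff (Stable.summand-vanish n n<k) n ℕₚ.≤-refl))

  pochInf-q²≈ : pochInf (⊖ qˆ 3) q² ≈ P 3
  pochInf-q²≈ = mk λ n n≤N → sym (coeff (Stable.poch-q²-stable n 3 n≤N) n ℕₚ.≤-refl)

  pochInf-q≈ : ∀ {M} → N ≤ M → pochInf q q ≈ poch q q M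
  pochInf-q≈ N≤M = mk λ n n≤N → trans
    (coeff (Stable.poch-q-stable n (ℕₚ.n≤1+n n)) n ℕₚ.≤-refl)
    (sym (coeff (Stable.poch-q-stable n (ℕₚ.≤-trans n≤N N≤M)) n ℕₚ.≤-refl))

  -- The first n factors of (-q³;q²)_∞ cancel the denominator (-q³;q²)_n.
  summand-⊗-P : ∀ n → summand n ⊗ P 3 ≈ t n 0
  summand-⊗-P n = begin
    (e ⊗ a) ⊗ v ⊗ P 3
      ≈⟨ ⊗-congˡ ((e ⊗ a) ⊗ v) (P-split 3 n) ⟩
    (e ⊗ a) ⊗ v ⊗ (b ⊗ p)
      ≈⟨ solve 5 (λ e a v b p → ((e :* a) :* v) :* (b :* p) := e :* ((a :* (b :* v)) :* p)) ≈-refl e a v b p ⟩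
    e ⊗ ((a ⊗ (b ⊗ v)) ⊗ p)
      ≈⟨ ⊗-congˡ e (⊗-congʳ p (⊗-congˡ a bv≈)) ⟩
    e ⊗ (ratio n ⊗ p)
      ≡⟨ cong₂ (λ k l → qˆ k ⊗ (ratio n ⊗ P l)) (ℕₚ.+-identityʳ (n ℕ.* suc n)) (ℕₚ.+-identityʳ (3 ℕ.+ 2 ℕ.* n)) ⟨
    t n 0 ∎
    where
    e = qˆ (n ℕ.* suc n)
    a = poch (⊖ qˆ 2) q² n
    b = poch (⊖ qˆ 3) q² n
    c = poch q² q² n
    v = inv (b ⊗ c)
    p = P (3 ℕ.+ 2 ℕ.* n)
    b0 : b 0 ≡ + 1
    b0 = poch-const-term (⊖ qˆ 3) q² n refl
    c0 : c 0 ≡ + 1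
    c0 = poch-const-term q² q² n refl
    bv≈ : b ⊗ v ≈ inv c
    bv≈ = ⊗-cancelˡ {c} c0 (begin
      c ⊗ (b ⊗ v)   ≈⟨ solve 3 (λ c b v → c :* (b :* v) := (b :* c) :* v) ≈-refl c b v ⟩
      (b ⊗ c) ⊗ v   ≈⟨ ≗⇒≈ (⊗-inv (b ⊗ c) (⊗-const-term b c b0 c0)) ⟩
      𝟙             ≈⟨ ≗⇒≈ (⊗-inv c c0) ⟨
      c ⊗ inv c     ∎)

  ΣS-⊗ : ∀ M f g → ΣS M f ⊗ g ≈ ΣS M (λ n → f n ⊗ g)
  ΣS-⊗ zero    f g = ≈-refl
  ΣS-⊗ (suc M) f g = ≈-trans (≗⇒≈ (⊗-distribʳ g (ΣS M f) (f (suc M)))) (⊕-congʳ (f (suc M) ⊗ g) (ΣS-⊗ M f g))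

  ΣS-cong : ∀ M {f g} → (∀ n → f n ≈ g n) → ΣS M f ≈ ΣS M g
  ΣS-cong zero    eq = eq 0
  ΣS-cong (suc M) eq = ⊕-cong (ΣS-cong M eq) (eq (suc M))

  sum⊗pochInf : sumSeries ⊗ pochInf (⊖ qˆ 3) q² ≈ H 0
  sum⊗pochInf = begin
    sumSeries ⊗ pochInf (⊖ qˆ 3) q²   ≈⟨ ⊗-cong sumSeries≈ pochInf-q²≈ ⟩
    ΣS N summand ⊗ P 3                ≈⟨ ΣS-⊗ N summand (P 3) ⟩
    ΣS N (λ n → summand n ⊗ P 3)      ≈⟨ ΣS-cong N summand-⊗-P ⟩
    H 0                               ∎

  -- `M` stays free because the chain recurrences produce (q;q)_(4+2N), which agrees with (q;q)_∞
  -- modulo q^(N+1).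
  rhs-characterisation : ∀ {M} F → N ≤ M → poch q q M ⊗ F ≈ H 0 → rhs ≈ F
  rhs-characterisation {M} F N≤M eq = ⊗-cancelˡ {p} p0 (begin
    p ⊗ (sumSeries ⊗ pochInf (⊖ qˆ 3) q² ⊗ inv p)
      ≈⟨ solve 3 (λ p s v → p :* (s :* v) := s :* (p :* v)) ≈-refl p (sumSeries ⊗ pochInf (⊖ qˆ 3) q²) (inv p) ⟩
    (sumSeries ⊗ pochInf (⊖ qˆ 3) q²) ⊗ (p ⊗ inv p)
      ≈⟨ ⊗-cong sum⊗pochInf (≗⇒≈ (⊗-inv p p0)) ⟩
    H 0 ⊗ 𝟙
      ≈⟨ *-identityʳ (H 0) ⟩
    H 0
      ≈⟨ eq ⟨
    poch q q M ⊗ F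
      ≈⟨ ⊗-congʳ F (pochInf-q≈ N≤M) ⟨
    p ⊗ F ∎)
    where
    p = pochInf q q
    p0 : p 0 ≡ + 1
    p0 = refl

-- Counting chains of shapes

open Equivalence using (to; from)

module _ {A : Set} where

  hasCount-unique : ∀ {P : A → Set} {k l} → HasCount P k → HasCount P l → k ≡ l
  hasCount-unique (xs , xs! , xs⇔ , refl) (ys , ys! , ys⇔ , refl) =
    ↭-length (∼bag⇒↭ (unique∧set⇒bag xs! ys! (λ {a} → mk⇔ (from (ys⇔ a) ∘ to (xs⇔ a)) (from (xs⇔ a) ∘ to (ys⇔ a)))))

  hasCount-⇔ : ∀ {P Q : A → Set} {k} → (∀ a → P a ⇔ Q a) → HasCount P k → HasCount Q k
  hasCount-⇔ P⇔Q (xs , xs! , xs⇔ , eq) =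
    xs , xs! , (λ a → mk⇔ (to (P⇔Q a) ∘ to (xs⇔ a)) (from (xs⇔ a) ∘ from (P⇔Q a))) , eq

  hasCount-∅ : ∀ {P : A → Set} → (∀ a → ¬ P a) → HasCount P 0
  hasCount-∅ ¬P = [] , [] , (λ a → mk⇔ (λ ()) (⊥-elim ∘ ¬P a)) , refl

  hasCount-⊎ : ∀ {P Q : A → Set} {k l} → (∀ a → P a → ¬ Q a) →
               HasCount P k → HasCount Q l → HasCount (λ a → P a ⊎ Q a) (k ℕ.+ l)
  hasCount-⊎ disjoint (xs , xs! , xs⇔ , refl) (ys , ys! , ys⇔ , refl) =
    xs ++ ys ,
    Uniqueₚ.++⁺ xs! ys! (λ { (a∈xs , a∈ys) → disjoint _ (to (xs⇔ _) a∈xs) (to (ys⇔ _) a∈ys) }) ,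
    (λ a → mk⇔
      ([ inj₁ ∘ to (xs⇔ a) , inj₂ ∘ to (ys⇔ a) ]′ ∘ ∈-++⁻ xs)
      [ ∈-++⁺ˡ ∘ from (xs⇔ a) , ∈-++⁺ʳ xs ∘ from (ys⇔ a) ]′) ,
    Listₚ.length-++ xs

  hasCount-∖ : ∀ {P Q : A → Set} {k l} → (∀ a → Dec (Q a)) → (∀ a → Q a → P a) →
               HasCount P k → HasCount Q l → ∃ λ m → HasCount (λ a → P a × ¬ Q a) m × m ℕ.+ l ≡ k
  hasCount-∖ {P} {Q} Q? Q⇒P hP@(xs , xs! , xs⇔ , _) hQ =
    length ys , hD , hasCount-unique (hasCount-⇔ D⊎Q⇔P (hasCount-⊎ (λ _ → proj₂) hD hQ)) hP
    where
    ¬Q? : ∀ a → Dec (¬ Q a)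
    ¬Q? a with Q? a
    ... | yes q = no λ ¬q → ¬q q
    ... | no ¬q = yes ¬q
    ys = filter ¬Q? xs
    hD : HasCount (λ a → P a × ¬ Q a) (length ys)
    hD = ys , Uniqueₚ.filter⁺ ¬Q? xs! ,
      (λ a → mk⇔
        (λ a∈ → let a∈xs , ¬q = ∈-filter⁻ ¬Q? {xs = xs} a∈ in to (xs⇔ a) a∈xs , ¬q)
        (λ { (p , ¬q) → ∈-filter⁺ ¬Q? (from (xs⇔ a) p) ¬q })) ,
      refl
    D⊎Q⇔P : ∀ a → ((P a × ¬ Q a) ⊎ Q a) ⇔ P a
    D⊎Q⇔P a = mk⇔ [ proj₁ , Q⇒P a ]′ split
      where
      split : P a → (P a × ¬ Q a) ⊎ Q a
      split p with Q? a
      ... | yes q = inj₂ q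
      ... | no ¬q = inj₁ (p , ¬q)

-- Injectivity is asked on members only: `column` separates chains, but not arbitrary lists of
-- pairs, since the pair (0 , 0) adds nothing.
unique-map : ∀ {A B : Set} (f : A → B) {xs} →
  (∀ {x y} → x ∈ xs → y ∈ xs → f x ≡ f y → x ≡ y) → Unique xs → Unique (map f xs)
unique-map f inj []         = []
unique-map f inj (x∉ ∷ xs!) =
  Allₚ.map⁺ (All.tabulate λ y∈ fx≡fy → All.lookup x∉ y∈ (inj (here refl) (there y∈) fx≡fy))
  ∷ unique-map f (λ x∈ y∈ → inj (there x∈) (there y∈)) xs!

hasCount-bijection : ∀ {A B : Set} {P : A → Set} {Q : B → Set} {k} (f : A → B) →
  (∀ a → P a → Q (f a)) →
  (∀ {a a′} → P a → P a′ → f a ≡ f a′ → a ≡ a′) →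
  (∀ b → Q b → ∃ λ a → P a × f a ≡ b) →
  HasCount P k → HasCount Q k
hasCount-bijection {Q = Q} f f-maps f-inj f-surj (xs , xs! , xs⇔ , eq) =
  map f xs ,
  unique-map f (λ a∈ a′∈ → f-inj (to (xs⇔ _) a∈) (to (xs⇔ _) a′∈)) xs! ,
  (λ b → mk⇔ maps surj) ,
  trans (Listₚ.length-map f xs) eq
  where
  maps : ∀ {b} → b ∈ map f xs → Q b
  maps b∈ with a , a∈ , refl ← ∈-map⁻ f b∈ = f-maps a (to (xs⇔ a) a∈)
  surj : ∀ {b} → Q b → b ∈ map f xs
  surj {b} q with a , p , refl ← f-surj b q = ∈-map⁺ f (from (xs⇔ a) p)

-- Chains of shapes below a bound

Shape : ℕ → ℕ → Set
Shape x y = 1 ≤ x × y ≤ x × x ≤ 4 ℕ.+ y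

Shapes : Set
Shapes = List (ℕ × ℕ)

-- The bound itself may lie outside the strip; this is what lets the corner relation be used on its
-- edges. Empty shapes are excluded, so a chain has only one representation.
Chain : ℕ → ℕ → Shapes → Set
Chain x y []              = ⊤
Chain x y ((x′ , y′) ∷ c) = (x′ ≤ x × y′ ≤ y) × Shape x′ y′ × Chain x′ y′ c

weight : Shapes → ℕ
weight []            = 0
weight ((x , y) ∷ c) = (x ℕ.+ y) ℕ.+ weight c

Bounded : ℕ → ℕ → ℕ → Shapes → Set
Bounded x y N c = Chain x y c × weight c ≡ N

shape? : ∀ x y → Dec (Shape x y)
shape? x y = (1 ℕ.≤? x) ×-dec (y ℕ.≤? x) ×-dec (x ℕ.≤? 4 ℕ.+ y)

chain? : ∀ x y c → Dec (Chain x y c)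
chain? x y []              = yes tt
chain? x y ((x′ , y′) ∷ c) = ((x′ ℕ.≤? x) ×-dec (y′ ℕ.≤? y)) ×-dec shape? x′ y′ ×-dec chain? x′ y′ c

bounded? : ∀ x y N c → Dec (Bounded x y N c)
bounded? x y N c = chain? x y c ×-dec (weight c ℕ.≟ N)

chain-mono : ∀ {x y x′ y′} c → x ≤ x′ → y ≤ y′ → Chain x y c → Chain x′ y′ c
chain-mono []      _    _    _                      = tt
chain-mono (_ ∷ c) x≤x′ y≤y′ ((a≤ , b≤) , sh , ch) = (ℕₚ.≤-trans a≤ x≤x′ , ℕₚ.≤-trans b≤ y≤y′) , sh , ch

bounded-mono : ∀ {x y x′ y′ N} c → x ≤ x′ → y ≤ y′ → Bounded x y N c → Bounded x′ y′ N c
bounded-mono c x≤x′ y≤y′ (ch , wt) = chain-mono c x≤x′ y≤y′ ch , wt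

-- Chains whose largest shape is the bound. The remaining weight `M` is tied to `N` by an addition,
-- so that a shape heavier than `N` simply admits no chain.
data Headed (x y N : ℕ) : Shapes → Set where
  headed : ∀ {c M} → Shape x y → Bounded x y M c → (x ℕ.+ y) ℕ.+ M ≡ N → Headed x y N ((x , y) ∷ c)

headed⇒bounded : ∀ {x y N} c → Headed x y N c → Bounded x y N c
headed⇒bounded _ (headed sh (ch , refl) eq) = ((ℕₚ.≤-refl , ℕₚ.≤-refl) , sh , ch) , eq

hasCount-headed : ∀ {x y N k} → Shape x y → HasCount (Bounded x y N) k → HasCount (Headed x y ((x ℕ.+ y) ℕ.+ N)) k
hasCount-headed {x} {y} {N} sh = hasCount-bijection ((x , y) ∷_)
  (λ _ b → headed sh b refl) (λ _ _ → λ { refl → refl })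
  λ { _ (headed {c} {M} _ (ch , wt) eq) → c , (ch , trans wt (ℕₚ.+-cancelˡ-≡ (x ℕ.+ y) M N eq)) , refl }

hasCount-headed-light : ∀ {x y N} → N < x ℕ.+ y → HasCount (Headed x y N) 0
hasCount-headed-light {x} {y} N< = hasCount-∅ λ { _ (headed {M = M} _ _ refl) → ℕₚ.<⇒≱ N< (ℕₚ.m≤m+n (x ℕ.+ y) M) }

hasCount-headed-¬ : ∀ {x y N} → ¬ Shape x y → HasCount (Headed x y N) 0
hasCount-headed-¬ ¬sh = hasCount-∅ λ { _ (headed sh _ _) → ¬sh sh }

hasCount-row : ∀ {x N k₁ k₂} → HasCount (Bounded x 0 N) k₁ → HasCount (Headed (suc x) 0 N) k₂ →
  HasCount (Bounded (suc x) 0 N) (k₁ ℕ.+ k₂)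
hasCount-row {x} {N} h₁ h₂ = hasCount-⇔ (λ c → mk⇔ [ bounded-mono c (ℕₚ.n≤1+n x) ℕₚ.≤-refl , headed⇒bounded c ]′ (split c))
  (hasCount-⊎ disjoint h₁ h₂)
  where
  disjoint : ∀ c → Bounded x 0 N c → ¬ Headed (suc x) 0 N c
  disjoint _ (((x< , _) , _) , _) (headed _ _ _) = ℕₚ.1+n≰n x<
  split : ∀ c → Bounded (suc x) 0 N c → Bounded x 0 N c ⊎ Headed (suc x) 0 N c
  split []              (_ , wt) = inj₁ (tt , wt)
  split ((x′ , y′) ∷ c) (((x≤ , z≤n) , sh , ch) , wt) with ℕₚ.m≤n⇒m<n∨m≡n x≤
  ... | inj₁ x< = inj₁ (((ℕₚ.≤-pred x< , z≤n) , sh , ch) , wt)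
  ... | inj₂ refl = inj₂ (headed sh (ch , refl) wt)

-- Inclusion and exclusion: a largest shape other than the corner has first coordinate at most x or
-- second at most y, and both hold exactly below (x , y). For a disjoint union the overlap is
-- removed from the chains below (x , y+1).
hasCount-corner : ∀ {x y N k₁ k₂ k₃ k₄} →
  HasCount (Bounded (suc x) y N) k₁ → HasCount (Bounded x (suc y) N) k₂ → HasCount (Bounded x y N) k₃ →
  HasCount (Headed (suc x) (suc y) N) k₄ →
  ∃ λ k → HasCount (Bounded (suc x) (suc y) N) k × k ℕ.+ k₃ ≡ k₁ ℕ.+ k₂ ℕ.+ k₄
hasCount-corner {x} {y} {N} {k₁} {k₂} {k₃} {k₄} h₁ h₂ h₃ h₄
  with m , hm , m+k₃≡k₂ ← hasCount-∖ (bounded? x y N) (λ c → bounded-mono c ℕₚ.≤-refl (ℕₚ.n≤1+n y)) h₂ h₃ =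
  k₁ ℕ.+ m ℕ.+ k₄ ,
  hasCount-⇔ (λ c → mk⇔
      [ [ bounded-mono c ℕₚ.≤-refl (ℕₚ.n≤1+n y) , bounded-mono c (ℕₚ.n≤1+n x) ℕₚ.≤-refl ∘ proj₁ ]′ , headed⇒bounded c ]′
      (split c))
    (hasCount-⊎ disjoint₂ (hasCount-⊎ disjoint₁ h₁ hm) h₄) ,
  (begin
    k₁ ℕ.+ m ℕ.+ k₄ ℕ.+ k₃     ≡⟨ ℕₚ.+-assoc (k₁ ℕ.+ m) k₄ k₃ ⟩
    k₁ ℕ.+ m ℕ.+ (k₄ ℕ.+ k₃)   ≡⟨ cong (k₁ ℕ.+ m ℕ.+_) (ℕₚ.+-comm k₄ k₃) ⟩
    k₁ ℕ.+ m ℕ.+ (k₃ ℕ.+ k₄)   ≡⟨ sym (ℕₚ.+-assoc (k₁ ℕ.+ m) k₃ k₄) ⟩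
    k₁ ℕ.+ m ℕ.+ k₃ ℕ.+ k₄     ≡⟨ cong (ℕ._+ k₄) (ℕₚ.+-assoc k₁ m k₃) ⟩
    k₁ ℕ.+ (m ℕ.+ k₃) ℕ.+ k₄   ≡⟨ cong (λ l → k₁ ℕ.+ l ℕ.+ k₄) m+k₃≡k₂ ⟩
    k₁ ℕ.+ k₂ ℕ.+ k₄           ∎)
  where
  open ≡-Reasoning
  R : Shapes → Set
  R c = Bounded x (suc y) N c × ¬ Bounded x y N c
  disjoint₁ : ∀ c → Bounded (suc x) y N c → ¬ R c
  disjoint₁ []      b                         (_ , ¬b)                    = ¬b b
  disjoint₁ (_ ∷ _) (((_ , y≤) , _) , _) ((((x≤ , _) , rest) , wt) , ¬b) = ¬b (((x≤ , y≤) , rest) , wt)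
  disjoint₂ : ∀ c → Bounded (suc x) y N c ⊎ R c → ¬ Headed (suc x) (suc y) N c
  disjoint₂ _ (inj₁ (((_ , y<) , _) , _))       (headed _ _ _) = ℕₚ.1+n≰n y<
  disjoint₂ _ (inj₂ ((((x< , _) , _) , _) , _)) (headed _ _ _) = ℕₚ.1+n≰n x<
  split : ∀ c → Bounded (suc x) (suc y) N c → (Bounded (suc x) y N c ⊎ R c) ⊎ Headed (suc x) (suc y) N c
  split []              (_ , wt) = inj₁ (inj₁ (tt , wt))
  split ((x′ , y′) ∷ c) (((x≤ , y≤) , sh , ch) , wt) with ℕₚ.m≤n⇒m<n∨m≡n y≤ | ℕₚ.m≤n⇒m<n∨m≡n x≤
  ... | inj₁ y<   | _         = inj₁ (inj₁ (((x≤ , ℕₚ.≤-pred y<) , sh , ch) , wt))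
  ... | inj₂ refl | inj₁ x<   = inj₁ (inj₂ ((((ℕₚ.≤-pred x< , ℕₚ.≤-refl) , sh , ch) , wt) , λ { (((_ , y<) , _) , _) → ℕₚ.1+n≰n y< }))
  ... | inj₂ refl | inj₂ refl = inj₂ (headed sh (ch , refl) wt)

-- The recurrence for A, run as an enumeration. Splitting off a shape lowers the weight by x + y ≥ 1
-- and uses fuel; between two such steps the bound decreases.
countBelow : ∀ fuel N → N < fuel → ∀ x y → ∃ (HasCount (Bounded x y N))
headedBelow : ∀ fuel N → N < fuel → ∀ x y → ∃ (HasCount (Headed x y N))

countBelow fuel zero    N< zero y = 1 , ([] ∷ []) , (All.[] ∷ []) ,
  (λ { []      → mk⇔ (λ _ → tt , refl) (λ _ → here refl)
     ; (_ ∷ _) → mk⇔ (λ { (here ()) ; (there ()) }) (λ { (((z≤n , _) , (() , _) , _) , _) }) }) , refl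
countBelow fuel (suc N) N< zero y = 0 , hasCount-∅ λ { [] (_ , ()) ; (_ ∷ _) (((z≤n , _) , (() , _) , _) , _) }
countBelow fuel N N< (suc x) zero    =
  _ , hasCount-row (proj₂ (countBelow fuel N N< x 0)) (proj₂ (headedBelow fuel N N< (suc x) 0))
countBelow fuel N N< (suc x) (suc y) = _ , proj₁ (proj₂ (hasCount-corner
  (proj₂ (countBelow fuel N N< (suc x) y)) (proj₂ (countBelow fuel N N< x (suc y)))
  (proj₂ (countBelow fuel N N< x y)) (proj₂ (headedBelow fuel N N< (suc x) (suc y)))))

headedBelow (suc fuel) N N< x y with shape? x y | (x ℕ.+ y) ℕ.≤? N
... | no ¬sh | _       = 0 , hasCount-headed-¬ ¬sh
... | yes sh | no  s≰N = 0 , hasCount-headed-light (ℕₚ.≰⇒> s≰N)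
... | yes sh | yes s≤N = proj₁ rest ,
  subst (λ M → HasCount (Headed x y M) (proj₁ rest)) (ℕₚ.m+[n∸m]≡n s≤N) (hasCount-headed sh (proj₂ rest))
  where
  N∸s< : N ∸ (x ℕ.+ y) < fuel
  N∸s< = ℕₚ.<-≤-trans
    (ℕₚ.∸-monoʳ-< {N} {x ℕ.+ y} {0} (ℕₚ.≤-trans (proj₁ sh) (ℕₚ.m≤m+n x y)) s≤N)
    (ℕₚ.≤-pred N<)
  rest : ∃ (HasCount (Bounded x y (N ∸ (x ℕ.+ y))))
  rest = countBelow fuel (N ∸ (x ℕ.+ y)) N∸s< x y

countBounded : ∀ x y N → ∃ (HasCount (Bounded x y N))
countBounded x y N = countBelow (suc N) N ℕₚ.≤-refl x y

-- The generating functions of chains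

abstract
  -- Abstract, so that the enumeration is never unfolded; `A-count` is all that is known of it.
  A : ℕ → ℕ → Series
  A x y N = + proj₁ (countBounded x y N)

  A-count : ∀ x y N → ∃ λ k → HasCount (Bounded x y N) k × A x y N ≡ + k
  A-count x y N = proj₁ (countBounded x y N) , proj₂ (countBounded x y N) , refl

A-unique : ∀ {x y N k} → HasCount (Bounded x y N) k → A x y N ≡ + k
A-unique {x} {y} {N} h with l , hl , eq ← A-count x y N = trans eq (cong +_ (hasCount-unique hl h))

headed-count : ∀ {x y} N → Shape x y → ∃ λ k → HasCount (Headed x y N) k × (qˆ (x ℕ.+ y) ⊗ A x y) N ≡ + k
headed-count {x} {y} N sh with (x ℕ.+ y) ℕ.≤? N
... | no s≰N  = 0 , hasCount-headed-light (ℕₚ.≰⇒> s≰N) , qˆ-⊗-low (x ℕ.+ y) (A x y) N (ℕₚ.≰⇒> s≰N)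
... | yes s≤N with k , hk , eq ← A-count x y (N ∸ (x ℕ.+ y)) = k ,
  subst (λ M → HasCount (Headed x y M) k × (qˆ (x ℕ.+ y) ⊗ A x y) M ≡ + k) (ℕₚ.m+[n∸m]≡n s≤N)
    (hasCount-headed sh hk , trans (qˆ-⊗-shift (x ℕ.+ y) (A x y) (N ∸ (x ℕ.+ y))) eq)

A-corner : ∀ x y → Shape (suc x) (suc y) →
  A (suc x) (suc y) ⊕ A x y ≗ˢ A (suc x) y ⊕ A x (suc y) ⊕ qˆ (suc x ℕ.+ suc y) ⊗ A (suc x) (suc y)
A-corner x y sh N
  with k₁ , h₁ , eq₁ ← A-count (suc x) y N
     | k₂ , h₂ , eq₂ ← A-count x (suc y) N
     | k₃ , h₃ , eq₃ ← A-count x y N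
     | k₄ , h₄ , eq₄ ← headed-count {suc x} {suc y} N sh
  with k , hk , eq ← hasCount-corner h₁ h₂ h₃ h₄ =
  trans (cong₂ ℤ._+_ (A-unique hk) eq₃)
    (trans (cong +_ eq) (sym (cong₂ ℤ._+_ (cong₂ ℤ._+_ eq₁ eq₂) eq₄)))

A-row : ∀ x → x ≤ 3 → A (suc x) 0 ≗ˢ A x 0 ⊕ qˆ (suc x ℕ.+ 0) ⊗ A (suc x) 0
A-row x x≤3 N
  with k₁ , h₁ , eq₁ ← A-count x 0 N
     | k₂ , h₂ , eq₂ ← headed-count {suc x} {0} N (s≤s z≤n , z≤n , s≤s x≤3) =
  trans (A-unique (hasCount-row h₁ h₂)) (sym (cong₂ ℤ._+_ eq₁ eq₂))

A-cong : ∀ {x y x′ y′} → (∀ c → Chain x y c ⇔ Chain x′ y′ c) → A x y ≗ˢ A x′ y′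
A-cong {x} {y} eq N with k , h , A≡ ← A-count x y N =
  trans A≡ (sym (A-unique (hasCount-⇔ (λ c → mk⇔ (λ { (ch , wt) → to (eq c) ch , wt }) (λ { (ch , wt) → from (eq c) ch , wt })) h)))
  where open Equivalence

-- Shapes have y ≤ x, so a bound one step beyond the diagonal admits nothing new. With `A-edge` this
-- closes the recurrence inside the strip.
A-diagonal : ∀ x → A x (suc x) ≗ˢ A x x
A-diagonal x = A-cong λ
  { []      → mk⇔ (λ _ → tt) (λ _ → tt)
  ; (s ∷ c) → mk⇔ (λ { ((x≤ , _) , sh@(_ , y≤x , _) , ch) → (x≤ , ℕₚ.≤-trans y≤x x≤) , sh , ch })
                  (chain-mono (s ∷ c) ℕₚ.≤-refl (ℕₚ.n≤1+n x)) }

-- The same at the other side of the strip, from x ≤ 4 + y.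
A-edge : ∀ y → A (5 ℕ.+ y) y ≗ˢ A (4 ℕ.+ y) y
A-edge y = A-cong λ
  { []      → mk⇔ (λ _ → tt) (λ _ → tt)
  ; (s ∷ c) → mk⇔ (λ { ((_ , y≤) , sh@(_ , _ , x≤4+y) , ch) → (ℕₚ.≤-trans x≤4+y (ℕₚ.+-monoʳ-≤ 4 y≤) , y≤) , sh , ch })
                  (chain-mono (s ∷ c) (ℕₚ.n≤1+n (4 ℕ.+ y)) ℕₚ.≤-refl) }

A-origin : A 0 0 ≗ˢ 𝟙
A-origin zero    = A-unique (([] ∷ []) , (All.[] ∷ []) ,
  (λ { []      → mk⇔ (λ _ → tt , refl) (λ _ → here refl)
     ; (_ ∷ _) → mk⇔ (λ { (here ()) ; (there ()) }) (λ { (((z≤n , _) , (() , _) , _) , _) }) }) , refl)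
A-origin (suc N) = A-unique (hasCount-∅ λ { [] (_ , ()) ; (_ ∷ _) (((z≤n , _) , (() , _) , _) , _) })

-- Normalised generating functions along antidiagonals

module Growth (N : ℕ) where
  open Truncated N
  open Identity N
  open Sums N using (y; z)
  open SetoidReasoning setoid
  open ℕSolver.+-*-Solver using () renaming (solve to ℕ-solve; _:=_ to _⊜_; _:+_ to _⊞_; _:*_ to _⊠_; con to κ)

  D : ℕ → Series
  D = poch q q

  -- Solving the corner relation for its corner would divide by 1 - q^(x+y+2). Weighting each
  -- `A x y` with (q;q)_(x+y) supplies that factor.
  D-corner : ∀ x y {n} → n ≡ x ℕ.+ y → Shape (suc x) (suc y) →
    D (2 ℕ.+ n) ⊗ A (suc x) (suc y)
    ≈ D (1 ℕ.+ n) ⊗ A (suc x) y ⊕ D (1 ℕ.+ n) ⊗ A x (suc y) ⊕ ⊖ ((𝟙 ⊕ ⊖ qˆ (1 ℕ.+ n)) ⊗ (D n ⊗ A x y))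
  D-corner x y {n} refl sh = begin
    D (2 ℕ.+ n) ⊗ A₀
      ≈⟨ ⊗-congʳ A₀ (poch-q-last (1 ℕ.+ n)) ⟩
    (D (1 ℕ.+ n) ⊗ (𝟙 ⊕ ⊖ s)) ⊗ A₀
      ≈⟨ solve 4 (λ d s a b → (d :* (one :+ :- s)) :* a := d :* ((a :+ b) :+ :- (s :* a) :+ :- b)) ≈-refl (D (1 ℕ.+ n)) s A₀ A₃ ⟩
    D (1 ℕ.+ n) ⊗ ((A₀ ⊕ A₃) ⊕ ⊖ (s ⊗ A₀) ⊕ ⊖ A₃)
      ≈⟨ ⊗-congˡ (D (1 ℕ.+ n)) (⊕-congʳ (⊖ A₃) (⊕-congʳ (⊖ (s ⊗ A₀)) corner)) ⟩
    D (1 ℕ.+ n) ⊗ ((A₁ ⊕ A₂ ⊕ s ⊗ A₀) ⊕ ⊖ (s ⊗ A₀) ⊕ ⊖ A₃)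
      ≈⟨ solve 6 (λ d s a₀ a₁ a₂ a₃ → d :* ((a₁ :+ a₂ :+ s :* a₀) :+ :- (s :* a₀) :+ :- a₃) := (d :* a₁ :+ d :* a₂) :+ :- (d :* a₃))
           ≈-refl (D (1 ℕ.+ n)) s A₀ A₁ A₂ A₃ ⟩
    D (1 ℕ.+ n) ⊗ A₁ ⊕ D (1 ℕ.+ n) ⊗ A₂ ⊕ ⊖ (D (1 ℕ.+ n) ⊗ A₃)
      ≈⟨ ⊕-congˡ (D (1 ℕ.+ n) ⊗ A₁ ⊕ D (1 ℕ.+ n) ⊗ A₂) (⊖-cong (≈-trans (⊗-congʳ A₃ (poch-q-last n))
           (solve 3 (λ d s a → (d :* s) :* a := s :* (d :* a)) ≈-refl (D n) (𝟙 ⊕ ⊖ qˆ (1 ℕ.+ n)) A₃))) ⟩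
    D (1 ℕ.+ n) ⊗ A₁ ⊕ D (1 ℕ.+ n) ⊗ A₂ ⊕ ⊖ ((𝟙 ⊕ ⊖ qˆ (1 ℕ.+ n)) ⊗ (D n ⊗ A₃)) ∎
    where
    s = qˆ (2 ℕ.+ n)
    A₀ = A (suc x) (suc y)
    A₁ = A (suc x) y
    A₂ = A x (suc y)
    A₃ = A x y
    corner : A₀ ⊕ A₃ ≈ A₁ ⊕ A₂ ⊕ s ⊗ A₀
    corner = subst (λ m → A₀ ⊕ A₃ ≈ A₁ ⊕ A₂ ⊕ qˆ m ⊗ A₀) (cong suc (ℕₚ.+-suc x y)) (≗⇒≈ (A-corner x y sh))

  D-cover : ∀ n F G → F ≈ G ⊕ qˆ (suc n) ⊗ F → D (suc n) ⊗ F ≈ D n ⊗ G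
  D-cover n F G eq = begin
    D (suc n) ⊗ F                    ≈⟨ ⊗-congʳ F (poch-q-last n) ⟩
    (D n ⊗ (𝟙 ⊕ ⊖ s)) ⊗ F            ≈⟨ solve 3 (λ d s f → (d :* (one :+ :- s)) :* f := d :* (f :+ :- (s :* f))) ≈-refl (D n) s F ⟩
    D n ⊗ (F ⊕ ⊖ (s ⊗ F))            ≈⟨ ⊗-congˡ (D n) (⊕-congʳ (⊖ (s ⊗ F)) eq) ⟩
    D n ⊗ ((G ⊕ s ⊗ F) ⊕ ⊖ (s ⊗ F))  ≈⟨ solve 4 (λ d s f g → d :* ((g :+ s :* f) :+ :- (s :* f)) := d :* g) ≈-refl (D n) s F G ⟩
    D n ⊗ G                          ∎
    where s = qˆ (suc n)

  ⊕-cancelʳ : ∀ f g f′ h′ → f ⊕ g ≈ f′ ⊕ g ⊕ h′ → f ≈ f′ ⊕ h′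
  ⊕-cancelʳ f g f′ h′ eq = begin
    f                      ≈⟨ solve 2 (λ f g → f := (f :+ g) :+ :- g) ≈-refl f g ⟩
    (f ⊕ g) ⊕ ⊖ g          ≈⟨ ⊕-congʳ (⊖ g) eq ⟩
    (f′ ⊕ g ⊕ h′) ⊕ ⊖ g    ≈⟨ solve 3 (λ f g h → (f :+ g :+ h) :+ :- g := f :+ h) ≈-refl f′ g h′ ⟩
    f′ ⊕ h′                ∎

  -- By `A-diagonal` the term `A m m` stands on both sides of the corner relation and cancels; only
  -- the neighbour inside the strip is left.
  D-diagonal : ∀ m {n} → n ≡ m ℕ.+ m → D (2 ℕ.+ n) ⊗ A (suc m) (suc m) ≈ D (1 ℕ.+ n) ⊗ A (suc m) m
  D-diagonal m {n} refl = D-cover (1 ℕ.+ n) (A (suc m) (suc m)) (A (suc m) m)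
    (⊕-cancelʳ (A (suc m) (suc m)) (A m m) (A (suc m) m) (qˆ (2 ℕ.+ n) ⊗ A (suc m) (suc m)) (begin
      A (suc m) (suc m) ⊕ A m m
        ≈⟨ ≗⇒≈ (A-corner m m (s≤s z≤n , ℕₚ.≤-refl , ℕₚ.m≤n+m (suc m) 4)) ⟩
      A (suc m) m ⊕ A m (suc m) ⊕ qˆ (suc m ℕ.+ suc m) ⊗ A (suc m) (suc m)
        ≈⟨ ⊕-cong (⊕-congˡ (A (suc m) m) (≗⇒≈ (A-diagonal m)))
             (≈-reflexive (cong (λ k → qˆ k ⊗ A (suc m) (suc m)) (cong suc (ℕₚ.+-suc m m)))) ⟩
      A (suc m) m ⊕ A m m ⊕ qˆ (2 ℕ.+ n) ⊗ A (suc m) (suc m) ∎))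

  -- The analogous cancellation by `A-edge`; at `k = 0` there is no row below, and `A-row` takes the
  -- place of the corner relation.
  D-edge : ∀ k {n} → n ≡ k ℕ.+ k → D (4 ℕ.+ n) ⊗ A (4 ℕ.+ k) k ≈ D (3 ℕ.+ n) ⊗ A (3 ℕ.+ k) k
  D-edge zero    refl = D-cover 3 (A 4 0) (A 3 0) (≗⇒≈ (A-row 3 ℕₚ.≤-refl))
  D-edge (suc k) refl = D-cover (3 ℕ.+ (suc k ℕ.+ suc k)) A₀ A₁ (⊕-cancelʳ A₀ A₃ A₁ (qˆ (5 ℕ.+ k ℕ.+ suc k) ⊗ A₀) (begin
    A₀ ⊕ A₃
      ≈⟨ ≗⇒≈ (A-corner (4 ℕ.+ k) k (s≤s z≤n , s≤s (ℕₚ.m≤n+m k 4) , ℕₚ.≤-refl)) ⟩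
    A (5 ℕ.+ k) k ⊕ A₁ ⊕ qˆ (5 ℕ.+ k ℕ.+ suc k) ⊗ A₀
      ≈⟨ ⊕-congʳ (qˆ (5 ℕ.+ k ℕ.+ suc k) ⊗ A₀) (⊕-congʳ A₁ (≗⇒≈ (A-edge k))) ⟩
    A₃ ⊕ A₁ ⊕ qˆ (5 ℕ.+ k ℕ.+ suc k) ⊗ A₀
      ≈⟨ ⊕-congʳ (qˆ (5 ℕ.+ k ℕ.+ suc k) ⊗ A₀) (+-comm A₃ A₁) ⟩
    A₁ ⊕ A₃ ⊕ qˆ (5 ℕ.+ k ℕ.+ suc k) ⊗ A₀ ∎))
    where
    A₀ = A (5 ℕ.+ k) (suc k)
    A₁ = A (4 ℕ.+ k) (suc k)
    A₃ = A (4 ℕ.+ k) k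

  -- With y = 0 the chains are the partitions into parts at most x.
  D-row : ∀ x → x ≤ 4 → D x ⊗ A x 0 ≈ 𝟙
  D-row zero    _    = ≈-trans (*-identityˡ (A 0 0)) (≗⇒≈ A-origin)
  D-row (suc x) x<4  = ≈-trans
    (D-cover x (A (suc x) 0) (A x 0)
      (subst (λ k → A (suc x) 0 ≈ A x 0 ⊕ qˆ k ⊗ A (suc x) 0) (cong suc (ℕₚ.+-identityʳ x)) (≗⇒≈ (A-row x (ℕₚ.≤-pred x<4)))))
    (D-row x (ℕₚ.≤-trans (ℕₚ.n≤1+n x) x<4))

  -- The bounds of the strip on the antidiagonal x + y = 4 + 2i, with x - y equal to 2, 0 and 4. The
  -- index is m = i + 2, the first value at which all three exist.
  b a c w : ℕ → Series
  b i = D (4 ℕ.+ 2 ℕ.* i) ⊗ A (3 ℕ.+ i) (1 ℕ.+ i)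
  a i = D (4 ℕ.+ 2 ℕ.* i) ⊗ A (2 ℕ.+ i) (2 ℕ.+ i)
  c i = D (4 ℕ.+ 2 ℕ.* i) ⊗ A (4 ℕ.+ i) i
  w i = a i ⊕ c i

  D32 : D 3 ⊗ A 2 1 ≈ 𝟙 ⊕ 𝟙 ⊕ ⊖ (𝟙 ⊕ ⊖ (y ⊗ y))
  D32 = begin
    D 3 ⊗ A 2 1
      ≈⟨ D-corner 1 0 refl (s≤s z≤n , s≤s z≤n , s≤s (s≤s z≤n)) ⟩
    D 2 ⊗ A 2 0 ⊕ D 2 ⊗ A 1 1 ⊕ ⊖ ((𝟙 ⊕ ⊖ q²) ⊗ (D 1 ⊗ A 1 0))
      ≈⟨ ⊕-cong
           (⊕-cong (D-row 2 (s≤s (s≤s z≤n))) (≈-trans (D-diagonal 0 refl) (D-row 1 (s≤s z≤n))))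
           (⊖-cong (⊗-cong (⊕-congˡ 𝟙 (⊖-cong (qˆ-⊗ 1 1 refl))) (D-row 1 (s≤s z≤n)))) ⟩
    𝟙 ⊕ 𝟙 ⊕ ⊖ ((𝟙 ⊕ ⊖ (y ⊗ y)) ⊗ 𝟙)
      ≈⟨ ⊕-congˡ (𝟙 ⊕ 𝟙) (⊖-cong (*-identityʳ (𝟙 ⊕ ⊖ (y ⊗ y)))) ⟩
    𝟙 ⊕ 𝟙 ⊕ ⊖ (𝟙 ⊕ ⊖ (y ⊗ y)) ∎

  b-zero : b 0 ≈ 𝟙 ⊕ y ⊗ y ⊕ y ⊗ (y ⊗ y)
  b-zero = begin
    D 4 ⊗ A 3 1
      ≈⟨ D-corner 2 0 refl (s≤s z≤n , s≤s z≤n , s≤s (s≤s (s≤s z≤n))) ⟩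
    D 3 ⊗ A 3 0 ⊕ D 3 ⊗ A 2 1 ⊕ ⊖ ((𝟙 ⊕ ⊖ qˆ 3) ⊗ (D 2 ⊗ A 2 0))
      ≈⟨ ⊕-cong
           (⊕-cong (D-row 3 (s≤s (s≤s (s≤s z≤n)))) D32)
           (⊖-cong (⊗-cong (⊕-congˡ 𝟙 (⊖-cong (≈-trans (qˆ-⊗ 1 2 refl) (⊗-congˡ y (qˆ-⊗ 1 1 refl))))) (D-row 2 (s≤s (s≤s z≤n))))) ⟩
    𝟙 ⊕ (𝟙 ⊕ 𝟙 ⊕ ⊖ (𝟙 ⊕ ⊖ (y ⊗ y))) ⊕ ⊖ ((𝟙 ⊕ ⊖ (y ⊗ (y ⊗ y))) ⊗ 𝟙)
      ≈⟨ solve 1 (λ y → one :+ (one :+ one :+ :- (one :+ :- (y :* y))) :+ :- ((one :+ :- (y :* (y :* y))) :* one)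
           := one :+ y :* y :+ y :* (y :* y)) ≈-refl y ⟩
    𝟙 ⊕ y ⊗ y ⊕ y ⊗ (y ⊗ y) ∎

  w-zero : w 0 ≈ 𝟙 ⊕ 𝟙 ⊕ y ⊗ y
  w-zero = begin
    D 4 ⊗ A 2 2 ⊕ D 4 ⊗ A 4 0
      ≈⟨ ⊕-cong (≈-trans (D-diagonal 1 refl) D32) (D-row 4 ℕₚ.≤-refl) ⟩
    (𝟙 ⊕ 𝟙 ⊕ ⊖ (𝟙 ⊕ ⊖ (y ⊗ y))) ⊕ 𝟙
      ≈⟨ solve 1 (λ y → (one :+ one :+ :- (one :+ :- (y :* y))) :+ one := one :+ one :+ y :* y) ≈-refl y ⟩
    𝟙 ⊕ 𝟙 ⊕ y ⊗ y ∎

  module _ (i : ℕ) where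
    private
      n = 2 ℕ.* i
      ζ = qˆ (4 ℕ.+ n)

      n≡ : n ≡ i ℕ.+ i
      n≡ = cong (i ℕ.+_) (ℕₚ.+-identityʳ i)

      D-suc : ∀ f → D (4 ℕ.+ 2 ℕ.* suc i) ⊗ f ≈ D (6 ℕ.+ n) ⊗ f
      D-suc f = ≈-reflexive (cong (λ k → D k ⊗ f) (ℕ-solve 1 (λ i → κ 4 ⊞ κ 2 ⊠ (κ 1 ⊞ i) ⊜ κ 6 ⊞ κ 2 ⊠ i) refl i))

      z≈ζ : z (suc i) ≈ ζ
      z≈ζ = ≈-reflexive (cong qˆ (ℕ-solve 1 (λ i → κ 2 ⊞ κ 2 ⊠ (κ 1 ⊞ i) ⊜ κ 4 ⊞ κ 2 ⊠ i) refl i))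

      -- A bound on the odd antidiagonal in between. `D-diagonal`, read backwards, turns the
      -- subtracted term into (1 - ζ) times `a i`, which leaves only ζ times `a i`; `c-low` does the
      -- same with `D-edge`.
      a-low : D (5 ℕ.+ n) ⊗ A (3 ℕ.+ i) (2 ℕ.+ i) ≈ b i ⊕ ζ ⊗ a i
      a-low = begin
        D (5 ℕ.+ n) ⊗ A (3 ℕ.+ i) (2 ℕ.+ i)
          ≈⟨ D-corner (2 ℕ.+ i) (1 ℕ.+ i) (trans (cong (3 ℕ.+_) n≡) (cong (2 ℕ.+_) (sym (ℕₚ.+-suc i i))))
               (s≤s z≤n , ℕₚ.n≤1+n (2 ℕ.+ i) , ℕₚ.m≤n+m (3 ℕ.+ i) 3) ⟩
        b i ⊕ a i ⊕ ⊖ ((𝟙 ⊕ ⊖ ζ) ⊗ (D (3 ℕ.+ n) ⊗ A (2 ℕ.+ i) (1 ℕ.+ i)))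
          ≈⟨ ⊕-congˡ (b i ⊕ a i) (⊖-cong (⊗-congˡ (𝟙 ⊕ ⊖ ζ)
               (D-diagonal (1 ℕ.+ i) (trans (cong (2 ℕ.+_) n≡) (cong suc (sym (ℕₚ.+-suc i i))))))) ⟨
        b i ⊕ a i ⊕ ⊖ ((𝟙 ⊕ ⊖ ζ) ⊗ a i)
          ≈⟨ solve 3 (λ b a s → b :+ a :+ :- ((one :+ :- s) :* a) := b :+ s :* a) ≈-refl (b i) (a i) ζ ⟩
        b i ⊕ ζ ⊗ a i ∎

      c-low : D (5 ℕ.+ n) ⊗ A (4 ℕ.+ i) (1 ℕ.+ i) ≈ b i ⊕ ζ ⊗ c i
      c-low = begin
        D (5 ℕ.+ n) ⊗ A (4 ℕ.+ i) (1 ℕ.+ i)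
          ≈⟨ D-corner (3 ℕ.+ i) i (cong (3 ℕ.+_) n≡)
               (s≤s z≤n , ℕₚ.m≤n+m (1 ℕ.+ i) 3 , ℕₚ.n≤1+n (4 ℕ.+ i)) ⟩
        c i ⊕ b i ⊕ ⊖ ((𝟙 ⊕ ⊖ ζ) ⊗ (D (3 ℕ.+ n) ⊗ A (3 ℕ.+ i) i))
          ≈⟨ ⊕-congˡ (c i ⊕ b i) (⊖-cong (⊗-congˡ (𝟙 ⊕ ⊖ ζ) (D-edge i n≡))) ⟨
        c i ⊕ b i ⊕ ⊖ ((𝟙 ⊕ ⊖ ζ) ⊗ c i)
          ≈⟨ solve 3 (λ b c s → c :+ b :+ :- ((one :+ :- s) :* c) := b :+ s :* c) ≈-refl (b i) (c i) ζ ⟩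
        b i ⊕ ζ ⊗ c i ∎

    -- The two neighbours `a-low` and `c-low` are added, so `a i` and `c i` enter only through their
    -- sum; this is why `w` suffices.
    b-suc : b (suc i) ≈ (𝟙 ⊕ y ⊗ z (suc i)) ⊗ b i ⊕ z (suc i) ⊗ w i
    b-suc = begin
      b (suc i)
        ≈⟨ D-suc (A (4 ℕ.+ i) (2 ℕ.+ i)) ⟩
      D (6 ℕ.+ n) ⊗ A (4 ℕ.+ i) (2 ℕ.+ i)
        ≈⟨ D-corner (3 ℕ.+ i) (1 ℕ.+ i) (trans (cong (4 ℕ.+_) n≡) (cong (3 ℕ.+_) (sym (ℕₚ.+-suc i i))))
             (s≤s z≤n , ℕₚ.m≤n+m (2 ℕ.+ i) 2 , ℕₚ.m≤n+m (4 ℕ.+ i) 2) ⟩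
      D (5 ℕ.+ n) ⊗ A (4 ℕ.+ i) (1 ℕ.+ i) ⊕ D (5 ℕ.+ n) ⊗ A (3 ℕ.+ i) (2 ℕ.+ i) ⊕ ⊖ ((𝟙 ⊕ ⊖ qˆ (5 ℕ.+ n)) ⊗ b i)
        ≈⟨ ⊕-cong (⊕-cong c-low a-low) (⊖-cong (⊗-congʳ (b i) (⊕-congˡ 𝟙 (⊖-cong (qˆ-⊗ 1 (4 ℕ.+ n) refl))))) ⟩
      (b i ⊕ ζ ⊗ c i) ⊕ (b i ⊕ ζ ⊗ a i) ⊕ ⊖ ((𝟙 ⊕ ⊖ (y ⊗ ζ)) ⊗ b i)
        ≈⟨ solve 5 (λ b a c s y → (b :+ s :* c) :+ (b :+ s :* a) :+ :- ((one :+ :- (y :* s)) :* b)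
             := (one :+ y :* s) :* b :+ s :* (a :+ c)) ≈-refl (b i) (a i) (c i) ζ y ⟩
      (𝟙 ⊕ y ⊗ ζ) ⊗ b i ⊕ ζ ⊗ w i
        ≈⟨ ⊕-cong (⊗-congʳ (b i) (⊕-congˡ 𝟙 (⊗-congˡ y z≈ζ))) (⊗-congʳ (w i) z≈ζ) ⟨
      (𝟙 ⊕ y ⊗ z (suc i)) ⊗ b i ⊕ z (suc i) ⊗ w i ∎

    w-suc : w (suc i) ≈ b i ⊕ b i ⊕ z (suc i) ⊗ w i
    w-suc = begin
      a (suc i) ⊕ c (suc i)
        ≈⟨ ⊕-cong (D-suc (A (3 ℕ.+ i) (3 ℕ.+ i))) (D-suc (A (5 ℕ.+ i) (1 ℕ.+ i))) ⟩
      D (6 ℕ.+ n) ⊗ A (3 ℕ.+ i) (3 ℕ.+ i) ⊕ D (6 ℕ.+ n) ⊗ A (5 ℕ.+ i) (1 ℕ.+ i)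
        ≈⟨ ⊕-cong
             (D-diagonal (2 ℕ.+ i) (trans (cong (4 ℕ.+_) n≡) (cong (2 ℕ.+_) (sym (trans (ℕₚ.+-suc i (suc i)) (cong suc (ℕₚ.+-suc i i)))))))
             (D-edge (1 ℕ.+ i) (trans (cong (2 ℕ.+_) n≡) (cong suc (sym (ℕₚ.+-suc i i))))) ⟩
      D (5 ℕ.+ n) ⊗ A (3 ℕ.+ i) (2 ℕ.+ i) ⊕ D (5 ℕ.+ n) ⊗ A (4 ℕ.+ i) (1 ℕ.+ i)
        ≈⟨ ⊕-cong a-low c-low ⟩
      (b i ⊕ ζ ⊗ a i) ⊕ (b i ⊕ ζ ⊗ c i)
        ≈⟨ solve 4 (λ b a c s → (b :+ s :* a) :+ (b :+ s :* c) := b :+ b :+ s :* (a :+ c)) ≈-refl (b i) (a i) (c i) ζ ⟩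
      b i ⊕ b i ⊕ ζ ⊗ w i
        ≈⟨ ⊕-congˡ (b i ⊕ b i) (⊗-congʳ (w i) z≈ζ) ⟨
      b i ⊕ b i ⊕ z (suc i) ⊗ w i ∎

  rhs≈A : rhs ≈ A (3 ℕ.+ N) (1 ℕ.+ N)
  rhs≈A = RightSide.rhs-characterisation N (A (3 ℕ.+ N) (1 ℕ.+ N))
    (ℕₚ.≤-trans (ℕₚ.m≤m+n N (N ℕ.+ 0)) (ℕₚ.m≤n+m (2 ℕ.* N) 4))
    (Sums.Limit.limit N b w b-zero w-zero b-suc w-suc)

-- Cylindric partitions as chains of shapes

-- The trailing 0 makes sums of this form agree by computation with `size`.
Σ₄ : (Fin 4 → ℕ) → ℕ
Σ₄ f = f 0F ℕ.+ (f 1F ℕ.+ (f 2F ℕ.+ (f 3F ℕ.+ 0)))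

Σ₄-mono : ∀ {f g} → (∀ i → f i ≤ g i) → Σ₄ f ≤ Σ₄ g
Σ₄-mono f≤g = ℕₚ.+-mono-≤ (f≤g 0F) (ℕₚ.+-mono-≤ (f≤g 1F) (ℕₚ.+-mono-≤ (f≤g 2F) (ℕₚ.+-mono-≤ (f≤g 3F) z≤n)))

Σ₄-cong : ∀ {f g} → (∀ i → f i ≡ g i) → Σ₄ f ≡ Σ₄ g
Σ₄-cong f≡g = cong₂ ℕ._+_ (f≡g 0F) (cong₂ ℕ._+_ (f≡g 1F) (cong₂ ℕ._+_ (f≡g 2F) (cong (ℕ._+ 0) (f≡g 3F))))

Σ₄-+ : ∀ f g → Σ₄ (λ i → f i ℕ.+ g i) ≡ Σ₄ f ℕ.+ Σ₄ g
Σ₄-+ f g = solve 8 (λ a b c d a′ b′ c′ d′ →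
    (a :+ a′) :+ ((b :+ b′) :+ ((c :+ c′) :+ ((d :+ d′) :+ con 0)))
    := (a :+ (b :+ (c :+ (d :+ con 0)))) :+ (a′ :+ (b′ :+ (c′ :+ (d′ :+ con 0)))))
  refl (f 0F) (f 1F) (f 2F) (f 3F) (g 0F) (g 1F) (g 2F) (g 3F)
  where open ℕSolver.+-*-Solver

-- Lengths of the partitions in a shape

next : Fin 4 → Fin 4
next 0F = 1F
next 1F = 2F
next 2F = 3F
next 3F = 0F

-- The profile (1,0,0,0), read on the step from `i` to `next i`; its double `gap` is the given
-- profile.
wrap : Fin 4 → ℕ
wrap 3F = 1
wrap _  = 0

-- ⌈(x − i)/4⌉, the number of k < x with k ≡ i modulo 4.
col : Fin 4 → ℕ → ℕ
col i  zero    = 0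
col 0F (suc x) = suc (col 3F x)
col 1F (suc x) = col 0F x
col 2F (suc x) = col 1F x
col 3F (suc x) = col 2F x

col-next : ∀ i x → col (next i) x ≤ col i x ℕ.+ wrap i
col-next i  zero    = subst (_≤ wrap i) (sym (col-zero (next i))) z≤n
  where
  col-zero : ∀ i → col i 0 ≡ 0
  col-zero 0F = refl
  col-zero 1F = refl
  col-zero 2F = refl
  col-zero 3F = refl
col-next 0F (suc x) = ℕₚ.≤-trans (col-next 3F x) (ℕₚ.≤-reflexive (ℕₚ.+-suc (col 3F x) 0))
col-next 1F (suc x) = col-next 0F x
col-next 2F (suc x) = col-next 1F x
col-next 3F (suc x) = ℕₚ.≤-trans (s≤s (col-next 2F x)) (ℕₚ.≤-reflexive (sym (ℕₚ.+-suc (col 2F x) 0)))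

col-suc-≤ : ∀ i x → col i x ≤ col i (suc x)
col-suc-≤ 0F zero    = z≤n
col-suc-≤ 1F zero    = z≤n
col-suc-≤ 2F zero    = z≤n
col-suc-≤ 3F zero    = z≤n
col-suc-≤ 0F (suc x) = s≤s (col-suc-≤ 3F x)
col-suc-≤ 1F (suc x) = col-suc-≤ 0F x
col-suc-≤ 2F (suc x) = col-suc-≤ 1F x
col-suc-≤ 3F (suc x) = col-suc-≤ 2F x

col-mono : ∀ i {x y} → x ≤ y → col i x ≤ col i y
col-mono i {x} x≤y = go (ℕₚ.≤⇒≤′ x≤y)
  where
  go : ∀ {y} → x ℕ.≤′ y → col i x ≤ col i y
  go ℕ.≤′-refl            = ℕₚ.≤-refl
  go (ℕ.≤′-step {y} x≤′y) = ℕₚ.≤-trans (go x≤′y) (col-suc-≤ i y)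

col-4+ : ∀ i y → col i (4 ℕ.+ y) ≡ suc (col i y)
col-4+ 0F y = refl
col-4+ 1F y = refl
col-4+ 2F y = refl
col-4+ 3F y = refl

Σ₄-col : ∀ x → Σ₄ (λ i → col i x) ≡ x
Σ₄-col zero    = refl
Σ₄-col (suc x) = trans
  (solve 4 (λ a b c d → (con 1 :+ d) :+ (a :+ (b :+ (c :+ con 0))) := con 1 :+ (a :+ (b :+ (c :+ (d :+ con 0)))))
    refl (col 0F x) (col 1F x) (col 2F x) (col 3F x))
  (cong suc (Σ₄-col x))
  where open ℕSolver.+-*-Solver

-- The conditions say u₀ ≥ u₁ ≥ u₂ ≥ u₃ ≥ u₀ - 1. If u₀ = 0 all entries vanish; otherwise lowering
-- u₀ by one and rotating preserves the conditions, and `col` follows the same rotation.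
col-unique : ∀ x (u : Fin 4 → ℕ) → (∀ i → u (next i) ≤ u i ℕ.+ wrap i) → Σ₄ u ≡ x → ∀ i → col i x ≡ u i
col-unique zero u balanced Σu i = sym (u≡0 i)
  where
  u≡0 : ∀ i → u i ≡ col i 0
  u≡0 0F = ℕₚ.m+n≡0⇒m≡0 (u 0F) Σu
  u≡0 1F = ℕₚ.m+n≡0⇒m≡0 (u 1F) (ℕₚ.m+n≡0⇒n≡0 (u 0F) Σu)
  u≡0 2F = ℕₚ.m+n≡0⇒m≡0 (u 2F) (ℕₚ.m+n≡0⇒n≡0 (u 1F) (ℕₚ.m+n≡0⇒n≡0 (u 0F) Σu))
  u≡0 3F = ℕₚ.m+n≡0⇒m≡0 (u 3F) (ℕₚ.m+n≡0⇒n≡0 (u 2F) (ℕₚ.m+n≡0⇒n≡0 (u 1F) (ℕₚ.m+n≡0⇒n≡0 (u 0F) Σu)))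
col-unique (suc x) u balanced Σu with u 0F in u0
... | zero = contradiction (trans (sym Σu≡0) Σu) λ ()
  where
  u1 : u 1F ≡ 0
  u1 = ℕₚ.n≤0⇒n≡0 (ℕₚ.≤-trans (balanced 0F) (ℕₚ.≤-reflexive (trans (ℕₚ.+-identityʳ (u 0F)) u0)))
  u2 : u 2F ≡ 0
  u2 = ℕₚ.n≤0⇒n≡0 (ℕₚ.≤-trans (balanced 1F) (ℕₚ.≤-reflexive (trans (ℕₚ.+-identityʳ (u 1F)) u1)))
  u3 : u 3F ≡ 0
  u3 = ℕₚ.n≤0⇒n≡0 (ℕₚ.≤-trans (balanced 2F) (ℕₚ.≤-reflexive (trans (ℕₚ.+-identityʳ (u 2F)) u2)))
  Σu≡0 : u 1F ℕ.+ (u 2F ℕ.+ (u 3F ℕ.+ 0)) ≡ 0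
  Σu≡0 = cong₂ ℕ._+_ u1 (cong₂ ℕ._+_ u2 (cong (ℕ._+ 0) u3))
... | suc m = λ
  { 0F → trans (cong suc (IH 3F)) (sym u0)
  ; 1F → IH 0F
  ; 2F → IH 1F
  ; 3F → IH 2F }
  where
  open ℕSolver.+-*-Solver
  v : Fin 4 → ℕ
  v 0F = u 1F
  v 1F = u 2F
  v 2F = u 3F
  v 3F = m
  v-balanced : ∀ i → v (next i) ≤ v i ℕ.+ wrap i
  v-balanced 0F = balanced 1F
  v-balanced 1F = balanced 2F
  v-balanced 2F = ℕₚ.≤-pred (subst₂ _≤_ u0 (ℕₚ.+-suc (u 3F) 0) (balanced 3F))
  v-balanced 3F = subst (u 1F ≤_) (trans (ℕₚ.+-identityʳ (u 0F)) (trans u0 (ℕₚ.+-comm 1 m))) (balanced 0F)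
  IH : ∀ i → col i x ≡ v i
  IH = col-unique x v v-balanced (ℕₚ.suc-injective (trans
    (solve 4 (λ m a b c → con 1 :+ (a :+ (b :+ (c :+ (m :+ con 0)))) := con 1 :+ m :+ (a :+ (b :+ (c :+ con 0))))
      refl m (u 1F) (u 2F) (u 3F)) Σu))

len : Fin 4 → ℕ → ℕ → ℕ
len i x y = col i x ℕ.+ col i y

len-mono : ∀ i {x y x′ y′} → x ≤ x′ → y ≤ y′ → len i x y ≤ len i x′ y′
len-mono i x≤ y≤ = ℕₚ.+-mono-≤ (col-mono i x≤) (col-mono i y≤)

gap : Fin 4 → ℕ
gap i = wrap i ℕ.+ wrap i

len-next : ∀ i x y → len (next i) x y ≤ len i x y ℕ.+ gap i
len-next i x y = ℕₚ.≤-trans (ℕₚ.+-mono-≤ (col-next i x) (col-next i y))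
  (ℕₚ.≤-reflexive (solve 3 (λ a b w → (a :+ w) :+ (b :+ w) := (a :+ b) :+ (w :+ w)) refl (col i x) (col i y) (wrap i)))
  where open ℕSolver.+-*-Solver

Σ₄-len : ∀ x y → Σ₄ (λ i → len i x y) ≡ x ℕ.+ y
Σ₄-len x y = trans (Σ₄-+ (λ i → col i x) (λ i → col i y)) (cong₂ ℕ._+_ (Σ₄-col x) (Σ₄-col y))

halves : ∀ {a b} → b ≤ a → a ≤ suc b → ⌈ a ℕ.+ b /2⌉ ≡ a × ⌊ a ℕ.+ b /2⌋ ≡ b
halves {a} {b} b≤a a≤1+b with ℕₚ.m≤n⇒m<n∨m≡n b≤a
... | inj₂ refl = sym (ℕₚ.n≡⌈n+n/2⌉ a) , sym (ℕₚ.n≡⌊n+n/2⌋ a)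
... | inj₁ b<a with refl ← ℕₚ.≤-antisym a≤1+b b<a =
  cong suc (sym (ℕₚ.n≡⌊n+n/2⌋ b)) , sym (ℕₚ.n≡⌈n+n/2⌉ b)

-- Adding 4 to y raises every `col i y` by one, so in the strip the two columns differ by at most
-- one and are the rounded halves of their sum.
len-halves : ∀ i {x y} → Shape x y → ⌈ len i x y /2⌉ ≡ col i x × ⌊ len i x y /2⌋ ≡ col i y
len-halves i {x} {y} (_ , y≤x , x≤4+y) =
  halves (col-mono i y≤x) (ℕₚ.≤-trans (col-mono i x≤4+y) (ℕₚ.≤-reflexive (col-4+ i y)))

len-injective : ∀ {x y x′ y′} → Shape x y → Shape x′ y′ → (∀ i → len i x y ≡ len i x′ y′) → x ≡ x′ × y ≡ y′
len-injective {x} {y} {x′} {y′} sh sh′ eq =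
  trans (sym (Σ₄-col x)) (trans (Σ₄-cong col-x) (Σ₄-col x′)) ,
  trans (sym (Σ₄-col y)) (trans (Σ₄-cong col-y) (Σ₄-col y′))
  where
  col-x : ∀ i → col i x ≡ col i x′
  col-x i = trans (sym (proj₁ (len-halves i sh))) (trans (cong ⌈_/2⌉ (eq i)) (proj₁ (len-halves i sh′)))
  col-y : ∀ i → col i y ≡ col i y′
  col-y i = trans (sym (proj₂ (len-halves i sh))) (trans (cong ⌊_/2⌋ (eq i)) (proj₂ (len-halves i sh′)))

-- Adding a layer to a partition and removing it

layer : ℕ → List ℕ → List ℕ
layer zero    l       = l
layer (suc n) []      = 1 ∷ layer n []
layer (suc n) (x ∷ l) = suc x ∷ layer n l

-- It may stop at the first part below 2: in a partition all later parts are then below 2 as well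
-- and drop to 0.
peel : List ℕ → List ℕ
peel (suc (suc x) ∷ l) = suc x ∷ peel l
peel _                 = []

length-layer : ∀ n l → length l ≤ n → length (layer n l) ≡ n
length-layer zero    []      _         = refl
length-layer (suc n) []      _         = cong suc (length-layer n [] z≤n)
length-layer (suc n) (x ∷ l) (s≤s l≤n) = cong suc (length-layer n l l≤n)

sum-layer : ∀ n l → length l ≤ n → sum (layer n l) ≡ n ℕ.+ sum l
sum-layer zero    []      _         = refl
sum-layer (suc n) []      _         = cong suc (sum-layer n [] z≤n)
sum-layer (suc n) (x ∷ l) (s≤s l≤n) = cong suc (trans (cong (x ℕ.+_) (sum-layer n l l≤n))
  (solve 3 (λ x n s → x :+ (n :+ s) := n :+ (x :+ s)) refl x n (sum l)))
  where open ℕSolver.+-*-Solver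

part-layer : ∀ n l {j} → j < n → part (layer n l) j ≡ suc (part l j)
part-layer (suc n) []      {zero}  _         = refl
part-layer (suc n) []      {suc j} (s≤s j<n) = part-layer n [] j<n
part-layer (suc n) (x ∷ l) {zero}  _         = refl
part-layer (suc n) (x ∷ l) {suc j} (s≤s j<n) = part-layer n l j<n

part-beyond : ∀ l {j} → length l ≤ j → part l j ≡ 0
part-beyond []      _         = refl
part-beyond (x ∷ l) (s≤s l≤j) = part-beyond l l≤j

part-positive : ∀ {l} → All (1 ≤_) l → ∀ {j} → j < length l → 1 ≤ part l j
part-positive (p ∷ _)  {zero}  _         = p
part-positive (_ ∷ ps) {suc j} (s≤s j<l) = part-positive ps j<l

layer-positive : ∀ n {l} → length l ≤ n → All (1 ≤_) l → All (1 ≤_) (layer n l)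
layer-positive zero    _         ps       = ps
layer-positive (suc n) _         []       = ℕₚ.≤-refl ∷ layer-positive n z≤n []
layer-positive (suc n) (s≤s l≤n) (p ∷ ps) = s≤s z≤n ∷ layer-positive n l≤n ps

layer-linked : ∀ n {l} → length l ≤ n → Linked _≥_ l → Linked _≥_ (layer n l)
layer-linked zero          _               lk        = lk
layer-linked (suc zero)    _               []        = [-]
layer-linked (suc (suc n)) _               []        = ℕₚ.≤-refl ∷ layer-linked (suc n) z≤n []
layer-linked (suc zero)    _               [-]       = [-]
layer-linked (suc (suc n)) _               [-]       = s≤s z≤n ∷ layer-linked (suc n) z≤n []
layer-linked (suc (suc n)) (s≤s l≤n)       (x≥y ∷ lk) = s≤s x≥y ∷ layer-linked (suc n) l≤n lk
layer-linked (suc zero)    (s≤s ())        (_ ∷ _)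

layer-partition : ∀ n {l} → length l ≤ n → IsPartition l → IsPartition (layer n l)
layer-partition n l≤n (lk , ps) = layer-linked n l≤n lk , layer-positive n l≤n ps

peel-layer : ∀ n {l} → length l ≤ n → All (1 ≤_) l → peel (layer n l) ≡ l
peel-layer zero    {[]}        _         _        = refl
peel-layer (suc n) {[]}        _         _        = refl
peel-layer (suc n) {suc x ∷ l} (s≤s l≤n) (_ ∷ ps) = cong (suc x ∷_) (peel-layer n l≤n ps)

part-≤-head : ∀ {x l} → Linked _≥_ (x ∷ l) → ∀ j → part l j ≤ x
part-≤-head [-]        _       = z≤n
part-≤-head (x≥y ∷ _)  zero    = x≥y
part-≤-head (x≥y ∷ lk) (suc j) = ℕₚ.≤-trans (part-≤-head lk j) x≥y

layer-peel : ∀ {l} → IsPartition l → layer (length l) (peel l) ≡ l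
layer-peel {[]}              _              = refl
layer-peel {suc (suc x) ∷ l} (lk , _ ∷ ps)  = cong (suc (suc x) ∷_) (layer-peel (Linked.tail lk , ps))
-- From the first 1 onwards all parts are 1, and padding the empty list restores them.
layer-peel {suc zero ∷ l}    (lk , _ ∷ ps)  = cong (1 ∷_) (ones lk ps)
  where
  ones : ∀ {l} → Linked _≥_ (1 ∷ l) → All (1 ≤_) l → layer (length l) [] ≡ l
  ones [-]             []       = refl
  ones (s≤s z≤n ∷ lk) (s≤s z≤n ∷ ps) = cong (1 ∷_) (ones lk ps)

length-peel : ∀ l → length (peel l) ≤ length l
length-peel []                = z≤n
length-peel (zero ∷ l)        = z≤n
length-peel (suc zero ∷ l)    = z≤n
length-peel (suc (suc x) ∷ l) = s≤s (length-peel l)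

part-peel : ∀ {l} → Linked _≥_ l → ∀ j → part (peel l) j ≡ pred (part l j)
part-peel {[]}              lk j       = refl
part-peel {zero ∷ l}        lk zero    = refl
part-peel {zero ∷ l}        lk (suc j) = cong pred (sym (ℕₚ.n≤0⇒n≡0 (part-≤-head lk j)))
part-peel {suc zero ∷ l}    lk zero    = refl
part-peel {suc zero ∷ l}    lk (suc j) = sym (ℕₚ.n≤0⇒n≡0 (ℕₚ.pred-mono-≤ (part-≤-head lk j)))
part-peel {suc (suc x) ∷ l} lk zero    = refl
part-peel {suc (suc x) ∷ l} lk (suc j) = part-peel (Linked.tail lk) j

peel-positive : ∀ l → All (1 ≤_) (peel l)
peel-positive []                = []
peel-positive (zero ∷ l)        = []
peel-positive (suc zero ∷ l)    = []
peel-positive (suc (suc x) ∷ l) = s≤s z≤n ∷ peel-positive l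

peel-linked : ∀ {l} → Linked _≥_ l → Linked _≥_ (peel l)
peel-linked {[]}                              _          = []
peel-linked {zero ∷ _}                        _          = []
peel-linked {suc zero ∷ _}                    _          = []
peel-linked {suc (suc x) ∷ []}                _          = [-]
peel-linked {suc (suc x) ∷ zero ∷ _}          _          = [-]
peel-linked {suc (suc x) ∷ suc zero ∷ _}      _          = [-]
peel-linked {suc (suc x) ∷ suc (suc y) ∷ _}   (x≥y ∷ lk) = ℕₚ.≤-pred x≥y ∷ peel-linked lk

peel-partition : ∀ {l} → IsPartition l → IsPartition (peel l)
peel-partition {l} (lk , _) = peel-linked lk , peel-positive l

sum-peel : ∀ {l} → IsPartition l → sum l ≡ length l ℕ.+ sum (peel l)
sum-peel {l} p = trans (cong sum (sym (layer-peel p))) (sum-layer (length l) (peel l) (length-peel l))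

-- At `j = length μ` the condition forces part `length μ + k` of `ν` to be 0, hence absent.
cylCond-length : ∀ {μ ν k} → All (1 ≤_) ν → CylCond μ ν k → length ν ≤ length μ ℕ.+ k
cylCond-length {μ} {ν} {k} ps cond with length ν ℕ.≤? length μ ℕ.+ k
... | yes ≤k = ≤k
... | no ≰k  = contradiction
  (ℕₚ.≤-trans (part-positive ps (ℕₚ.≰⇒> ≰k)) (ℕₚ.≤-trans (cond (length μ)) (ℕₚ.≤-reflexive (part-beyond μ ℕₚ.≤-refl))))
  λ ()

cylCond-peel : ∀ {μ ν k} → Linked _≥_ μ → Linked _≥_ ν → CylCond μ ν k → CylCond (peel μ) (peel ν) k
cylCond-peel {k = k} μ↓ ν↓ cond j =
  subst₂ _≤_ (sym (part-peel ν↓ (j ℕ.+ k))) (sym (part-peel μ↓ j)) (ℕₚ.pred-mono-≤ (cond j))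

-- By `n ≤ m + k`, whenever the smaller part is raised the larger one is raised too; otherwise the
-- smaller one is 0.
cylCond-layer : ∀ {μ ν k m n} → length ν ≤ n → n ≤ m ℕ.+ k → CylCond μ ν k → CylCond (layer m μ) (layer n ν) k
cylCond-layer {μ} {ν} {k} {m} {n} ν≤n n≤m+k cond j with j ℕ.+ k ℕ.<? n
... | yes j+k<n = subst₂ _≤_ (sym (part-layer n ν j+k<n)) (sym (part-layer m μ j<m)) (s≤s (cond j))
  where
  j<m : j < m
  j<m = ℕₚ.+-cancelʳ-< k j m (ℕₚ.<-≤-trans j+k<n n≤m+k)
... | no j+k≮n = ℕₚ.≤-trans
  (ℕₚ.≤-reflexive (part-beyond (layer n ν) (ℕₚ.≤-trans (ℕₚ.≤-reflexive (length-layer n ν ν≤n)) (ℕₚ.≮⇒≥ j+k≮n)))) z≤n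

-- The bijection between chains and cylindric partitions

Columns : Set
Columns = Fin 4 → List ℕ

Cylindric : Columns → Set
Cylindric F = (∀ i → IsPartition (F i)) × (∀ i → CylCond (F i) (F (next i)) (gap i))

column : Shapes → Columns
column []            i = []
column ((x , y) ∷ c) i = layer (len i x y) (column c i)

length-column : ∀ {x y} c → Chain x y c → ∀ i → length (column c i) ≤ len i x y
length-column []              _                      i = z≤n
length-column ((x′ , y′) ∷ c) ((x≤ , y≤) , _ , ch) i = ℕₚ.≤-trans
  (ℕₚ.≤-reflexive (length-layer (len i x′ y′) (column c i) (length-column c ch i))) (len-mono i x≤ y≤)

column-cylindric : ∀ {x y} c → Chain x y c → Cylindric (column c)
column-cylindric []              _            = (λ _ → [] , []) , (λ _ _ → z≤n)
column-cylindric ((x′ , y′) ∷ c) (_ , _ , ch) with parts , conds ← column-cylindric c ch =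
  (λ i → layer-partition (len i x′ y′) (length-column c ch i) (parts i)) ,
  (λ i → cylCond-layer {column c i} {column c (next i)} {m = len i x′ y′} (length-column c ch (next i)) (len-next i x′ y′) (conds i))

column-weight : ∀ {x y} c → Chain x y c → Σ₄ (λ i → sum (column c i)) ≡ weight c
column-weight []              _            = refl
column-weight ((x′ , y′) ∷ c) (_ , _ , ch) = begin
  Σ₄ (λ i → sum (layer (len i x′ y′) (column c i)))  ≡⟨ Σ₄-cong (λ i → sum-layer (len i x′ y′) (column c i) (length-column c ch i)) ⟩
  Σ₄ (λ i → len i x′ y′ ℕ.+ sum (column c i))        ≡⟨ Σ₄-+ (λ i → len i x′ y′) (λ i → sum (column c i)) ⟩
  Σ₄ (λ i → len i x′ y′) ℕ.+ Σ₄ (λ i → sum (column c i)) ≡⟨ cong₂ ℕ._+_ (Σ₄-len x′ y′) (column-weight c ch) ⟩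
  x′ ℕ.+ y′ ℕ.+ weight c                             ∎
  where open ≡-Reasoning

-- The lengths of the partitions recover the first shape, and peeling recovers the rest.
column-injective : ∀ {x y x′ y′} c c′ → Chain x y c → Chain x′ y′ c′ → (∀ i → column c i ≡ column c′ i) → c ≡ c′
column-injective []                 []                 _ _ _  = refl
-- A shape with x ≥ 1 has a cell in the first partition, as `col 0F (suc a)` is positive.
column-injective []                 ((suc a , b) ∷ c′) _ _ eq = contradiction (eq 0F) (nonempty (column c′ 0F))
  where
  nonempty : ∀ {m} l → [] ≢ layer (suc m) l
  nonempty []      ()
  nonempty (_ ∷ _) ()
column-injective []                 ((zero , b) ∷ c′)  _ (_ , (() , _) , _) _
column-injective ((zero , b) ∷ c)   c′                 (_ , (() , _) , _) _ _
column-injective s@((suc a , b) ∷ c) []                ch ch′ eq = sym (column-injective {0} {0} [] s tt ch (sym ∘ eq))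
column-injective ((x , y) ∷ c)      ((x′ , y′) ∷ c′) (_ , sh , ch) (_ , sh′ , ch′) eq =
  cong₂ _∷_ (cong₂ _,_ (proj₁ x≡×y≡) (proj₂ x≡×y≡)) (column-injective c c′ ch ch′ tails)
  where
  x≡×y≡ : x ≡ x′ × y ≡ y′
  x≡×y≡ = len-injective sh sh′ λ i → trans (sym (length-layer (len i x y) (column c i) (length-column c ch i)))
    (trans (cong length (eq i)) (length-layer (len i x′ y′) (column c′ i) (length-column c′ ch′ i)))
  tails : ∀ i → column c i ≡ column c′ i
  tails i = trans (sym (peel-layer (len i x y) (length-column c ch i) (proj₂ (proj₁ (column-cylindric c ch) i))))
    (trans (cong peel (eq i)) (peel-layer (len i x′ y′) (length-column c′ ch′ i) (proj₂ (proj₁ (column-cylindric c′ ch′) i))))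

-- The coordinates x and y of the lowest layer: a partition of length n has ⌈n/2⌉ odd and ⌊n/2⌋ even
-- positions.
upper lower : Columns → ℕ
upper F = Σ₄ (λ i → ⌈ length (F i) /2⌉)
lower F = Σ₄ (λ i → ⌊ length (F i) /2⌋)

-- Every entry of the profile is even, so it passes through the rounding and leaves the profile
-- (1,0,0,0).
half-gap : ∀ i n → ⌊ n ℕ.+ gap i /2⌋ ≡ ⌊ n /2⌋ ℕ.+ wrap i
half-gap 0F n = trans (cong ⌊_/2⌋ (ℕₚ.+-identityʳ n)) (sym (ℕₚ.+-identityʳ ⌊ n /2⌋))
half-gap 1F n = trans (cong ⌊_/2⌋ (ℕₚ.+-identityʳ n)) (sym (ℕₚ.+-identityʳ ⌊ n /2⌋))
half-gap 2F n = trans (cong ⌊_/2⌋ (ℕₚ.+-identityʳ n)) (sym (ℕₚ.+-identityʳ ⌊ n /2⌋))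
half-gap 3F n = trans (cong ⌊_/2⌋ (ℕₚ.+-comm n 2)) (ℕₚ.+-comm 1 ⌊ n /2⌋)

half-step : ∀ i {m n} → m ≤ n ℕ.+ gap i → ⌊ m /2⌋ ≤ ⌊ n /2⌋ ℕ.+ wrap i
half-step i {n = n} m≤ = ℕₚ.≤-trans (ℕₚ.⌊n/2⌋-mono m≤) (ℕₚ.≤-reflexive (half-gap i n))

module _ {F : Columns} (F-cyl : Cylindric F) where
  private
    ℓ : Fin 4 → ℕ
    ℓ i = length (F i)

  ℓ-next : ∀ i → ℓ (next i) ≤ ℓ i ℕ.+ gap i
  ℓ-next i = cylCond-length {F i} {F (next i)} (proj₂ (proj₁ F-cyl (next i))) (proj₂ F-cyl i)

  len-upper-lower : ∀ i → len i (upper F) (lower F) ≡ ℓ i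
  len-upper-lower i = begin
    col i (upper F) ℕ.+ col i (lower F)
      -- Since ⌈n/2⌉ is ⌊(n+1)/2⌋, the upper halves are treated as lower halves of the successors.
      ≡⟨ cong₂ ℕ._+_ (col-unique (upper F) (λ i → ⌈ ℓ i /2⌉) (λ i → half-step i {suc (ℓ (next i))} {suc (ℓ i)} (s≤s (ℓ-next i))) refl i)
           (col-unique (lower F) (λ i → ⌊ ℓ i /2⌋) (λ i → half-step i (ℓ-next i)) refl i) ⟩
    ⌈ ℓ i /2⌉ ℕ.+ ⌊ ℓ i /2⌋
      ≡⟨ ℕₚ.+-comm ⌈ ℓ i /2⌉ ⌊ ℓ i /2⌋ ⟩
    ⌊ ℓ i /2⌋ ℕ.+ ⌈ ℓ i /2⌉
      ≡⟨ ℕₚ.⌊n/2⌋+⌈n/2⌉≡n (ℓ i) ⟩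
    ℓ i ∎
    where open ≡-Reasoning

  upper-lower-shape : 1 ≤ ℓ 0F → Shape (upper F) (lower F)
  upper-lower-shape 1≤ℓ =
    ℕₚ.≤-trans (ℕₚ.⌈n/2⌉-mono 1≤ℓ) (ℕₚ.m≤m+n ⌈ ℓ 0F /2⌉ _) ,
    Σ₄-mono (λ i → ℕₚ.⌊n/2⌋≤⌈n/2⌉ (ℓ i)) ,
    ℕₚ.≤-trans (Σ₄-mono (λ i → ℕₚ.⌊n/2⌋-mono (ℕₚ.n≤1+n (suc (ℓ i)))))
      (ℕₚ.≤-reflexive (Σ₄-+ (λ _ → 1) (λ i → ⌊ ℓ i /2⌋)))

  peel-cylindric : Cylindric (peel ∘ F)
  peel-cylindric =
    (λ i → peel-partition (proj₁ F-cyl i)) ,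
    (λ i → cylCond-peel {F i} {F (next i)} (proj₁ (proj₁ F-cyl i)) (proj₁ (proj₁ F-cyl (next i))) (proj₂ F-cyl i))

  -- The three zero entries of the profile make the first partition the longest, so testing it alone
  -- detects the empty tuple.
  all-empty : ℓ 0F ≡ 0 → ∀ i → F i ≡ []
  all-empty ℓ0 i = empty (F i) (ℕₚ.n≤0⇒n≡0 (ℓ≤ i))
    where
    empty : ∀ (l : List ℕ) → length l ≡ 0 → l ≡ []
    empty [] _ = refl
    step : ∀ i → gap i ≡ 0 → ℓ i ≤ 0 → ℓ (next i) ≤ 0
    step i g ℓ≤ = ℕₚ.≤-trans (ℓ-next i) (ℕₚ.+-mono-≤ ℓ≤ (ℕₚ.≤-reflexive g))
    ℓ₁≤ = step 0F refl (ℕₚ.≤-reflexive ℓ0)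
    ℓ₂≤ = step 1F refl ℓ₁≤
    ℓ≤ : ∀ i → ℓ i ≤ 0
    ℓ≤ 0F = ℕₚ.≤-reflexive ℓ0
    ℓ≤ 1F = ℓ₁≤
    ℓ≤ 2F = ℓ₂≤
    ℓ≤ 3F = step 2F refl ℓ₂≤

-- Each step peels off the lowest layer. The fuel bounds the total size, which drops by at least the
-- length of the first partition.
column-surjective : ∀ fuel {F} → Cylindric F → Σ₄ (sum ∘ F) ≤ fuel →
  ∃ λ c → Chain (upper F) (lower F) c × (∀ i → column c i ≡ F i)
column-surjective fuel {F} F-cyl size≤ with length (F 0F) ℕ.≟ 0
... | yes ℓ≡0 = [] , tt , (λ i → sym (all-empty F-cyl ℓ≡0 i))
column-surjective zero {F} F-cyl size≤ | no ℓ≢0 =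
  contradiction (ℕₚ.n≤0⇒n≡0 (ℕₚ.≤-trans ℓ≤sum (ℕₚ.≤-trans (ℕₚ.m≤m+n (sum (F 0F)) _) size≤))) ℓ≢0
  where
  ℓ≤sum : length (F 0F) ≤ sum (F 0F)
  ℓ≤sum = ℕₚ.≤-trans (ℕₚ.m≤m+n (length (F 0F)) (sum (peel (F 0F)))) (ℕₚ.≤-reflexive (sym (sum-peel (proj₁ F-cyl 0F))))
column-surjective (suc fuel) {F} F-cyl size≤ | no ℓ≢0 =
  (upper F , lower F) ∷ c ,
  ((ℕₚ.≤-refl , ℕₚ.≤-refl) , upper-lower-shape F-cyl 1≤ℓ ,
    chain-mono c (Σ₄-mono (λ i → ℕₚ.⌈n/2⌉-mono (length-peel (F i)))) (Σ₄-mono (λ i → ℕₚ.⌊n/2⌋-mono (length-peel (F i)))) ch) ,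
  (λ i → trans (cong₂ layer (len-upper-lower F-cyl i) (columns i)) (layer-peel (proj₁ F-cyl i)))
  where
  1≤ℓ : 1 ≤ length (F 0F)
  1≤ℓ = ℕₚ.n≢0⇒n>0 ℓ≢0
  smaller : suc (Σ₄ (sum ∘ peel ∘ F)) ≤ suc fuel
  smaller = begin
    1 ℕ.+ Σ₄ (sum ∘ peel ∘ F)                             ≤⟨ ℕₚ.+-monoˡ-≤ _ (ℕₚ.≤-trans 1≤ℓ (ℕₚ.m≤m+n (length (F 0F)) _)) ⟩
    Σ₄ (length ∘ F) ℕ.+ Σ₄ (sum ∘ peel ∘ F)               ≡⟨ Σ₄-+ (length ∘ F) (sum ∘ peel ∘ F) ⟨
    Σ₄ (λ i → length (F i) ℕ.+ sum (peel (F i)))          ≡⟨ Σ₄-cong (λ i → sum-peel (proj₁ F-cyl i)) ⟨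
    Σ₄ (sum ∘ F)                                          ≤⟨ size≤ ⟩
    suc fuel                                              ∎
    where open ℕₚ.≤-Reasoning
  rest : ∃ λ c → Chain (upper (peel ∘ F)) (lower (peel ∘ F)) c × (∀ i → column c i ≡ peel (F i))
  rest = column-surjective fuel (peel-cylindric F-cyl) (ℕₚ.≤-pred smaller)
  c = proj₁ rest
  ch = proj₁ (proj₂ rest)
  columns = proj₂ (proj₂ rest)

tuple : Shapes → Vec (List ℕ) 4
tuple c = column c 0F ∷ column c 1F ∷ column c 2F ∷ column c 3F ∷ []

cylindric⇒isCylindric : ∀ F → Cylindric F → IsCylindric profile (F 0F ∷ F 1F ∷ F 2F ∷ F 3F ∷ [])
cylindric⇒isCylindric F (parts , conds) =
  (parts 0F ∷ parts 1F ∷ parts 2F ∷ parts 3F ∷ []) ,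
  λ { 0F → conds 0F ; 1F → conds 1F ; 2F → conds 2F ; 3F → conds 3F }

isCylindric⇒cylindric : ∀ Λ → IsCylindric profile Λ → Cylindric (lookup Λ)
isCylindric⇒cylindric (_ ∷ _ ∷ _ ∷ _ ∷ []) ((p₀ ∷ p₁ ∷ p₂ ∷ p₃ ∷ []) , conds) =
  (λ { 0F → p₀ ; 1F → p₁ ; 2F → p₂ ; 3F → p₃ }) ,
  (λ { 0F → conds 0F ; 1F → conds 1F ; 2F → conds 2F ; 3F → conds 3F })

-- Each coordinate of the first shape is at most the weight, so the bound (3 + N , 1 + N) excludes
-- no chain of weight N.
chain-weight : ∀ {x y} c → Chain x y c → Chain (weight c) (weight c) c
chain-weight []            _             = tt
chain-weight ((x , y) ∷ c) (_ , sh , ch) =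
  (ℕₚ.≤-trans (ℕₚ.m≤m+n x y) (ℕₚ.m≤m+n (x ℕ.+ y) (weight c)) ,
   ℕₚ.≤-trans (ℕₚ.m≤n+m y x) (ℕₚ.m≤m+n (x ℕ.+ y) (weight c))) , sh , ch

hasCount-cylindric : ∀ {N k} → HasCount (Bounded (3 ℕ.+ N) (1 ℕ.+ N) N) k →
  HasCount (λ Λ → IsCylindric profile Λ × size Λ ≡ N) k
hasCount-cylindric {N} = hasCount-bijection tuple
  (λ { c (ch , wt) → cylindric⇒isCylindric (column c) (column-cylindric c ch) , trans (column-weight c ch) wt })
  (λ { {c} {c′} (ch , _) (ch′ , _) eq → column-injective c c′ ch ch′
         λ { 0F → cong (λ Λ → lookup Λ 0F) eq ; 1F → cong (λ Λ → lookup Λ 1F) eq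
           ; 2F → cong (λ Λ → lookup Λ 2F) eq ; 3F → cong (λ Λ → lookup Λ 3F) eq } })
  surjective
  where
  surjective : ∀ Λ → IsCylindric profile Λ × size Λ ≡ N → ∃ λ c → Bounded (3 ℕ.+ N) (1 ℕ.+ N) N c × tuple c ≡ Λ
  surjective Λ@(_ ∷ _ ∷ _ ∷ _ ∷ []) (Λ-cyl , refl)
    with c , ch , columns ← column-surjective (size Λ) (isCylindric⇒cylindric Λ Λ-cyl) ℕₚ.≤-refl =
    c ,
    (chain-mono c (ℕₚ.≤-trans (ℕₚ.≤-reflexive wt) (ℕₚ.m≤n+m (size Λ) 3)) (ℕₚ.≤-trans (ℕₚ.≤-reflexive wt) (ℕₚ.n≤1+n (size Λ)))
      (chain-weight c ch) , wt) ,
    cong₂ _∷_ (columns 0F) (cong₂ _∷_ (columns 1F) (cong₂ _∷_ (columns 2F) (cong (_∷ []) (columns 3F))))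
    where
    wt : weight c ≡ size Λ
    wt = trans (sym (column-weight c ch)) (Σ₄-cong (cong sum ∘ columns))

theorem5p4 : ∀ (N : ℕ) → ∃ λ (k : ℕ) →
    HasCount (λ (Λ : Vec (List ℕ) 4) → IsCylindric profile Λ × size Λ ≡ N) k
    × rhs N ≡ + k
theorem5p4 N with k , h , A≡ ← A-count (3 ℕ.+ N) (1 ℕ.+ N) N =
  k , hasCount-cylindric h , trans (coeff (Growth.rhs≈A N) N ℕₚ.≤-refl) A≡
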